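{- Let $p\in\mathbb R[x]$ be a polynomial of degree $d\ge 1$ with $p(0)=0$, and let $(n_i)_{i=1}^\infty$ be a sequence of positive integers. Then for every $\varepsilon>0$ there exists a finite non-empty set $\alpha\subset\mathbb N$ with gaps bounded by $d$ (i.e. $\alpha\in\mathcal S_d$) such that $\big\|p\big(\sum_{i\in\alpha}n_i\big)\big\|_{\mathbb R/\mathbb Z}\le\varepsilon$.
   Context: $\mathbb N=\{1,2,\dots\}$. $\|x\|_{\mathbb R/\mathbb Z}$ denotes the distance from $x\in\mathbb R$ to the nearest integer. For a finite set $\alpha=\{i_1<i_2<\dots<i_r\}$ its gaps are $i_2-i_1,\dots,i_r-i_{r-1}$. For $k\ge0$, $\mathcal S_k$ denotes the family of finite non-empty $\alpha\subset\mathbb N$ such that for every $i\in\alpha$, either $i=\max\alpha$ or there is $j\in\alpha$ with $i<j\le i+k$. -}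

module Defs where

open import Data.Integer.Base as ℤ using (ℤ; +_)
import Data.Integer.DivMod as ℤ
import Data.Integer.Properties as ℤ
open import Data.List.Base using (List; []; _∷_; map)
open import Data.List.Extrema.Nat using (max)
open import Data.List.Membership.Propositional using (_∈_)
open import Data.List.Relation.Unary.All using (All)
open import Data.List.Relation.Unary.Linked using (Linked)
open import Data.Nat.Base as ℕ using (ℕ; zero; suc)
open import Data.Nat.ListAction using (sum)
import Data.Nat.Properties as ℕ
open import Data.Product using (_×_; _,_; ∃-syntax)
open import Data.Rational.Base as ℚ
  using (ℚ; 0ℚ; 1ℚ; ½; _+_; _*_; _-_; -_; ∣_∣; _⊓_; _/_; floor; 1/_; toℚᵘ; ↥_; ↧_)
import Data.Rational.Properties as ℚ
open import Data.Rational.Solver using (module +-*-Solver)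
open import Data.Rational.Unnormalised.Base as ℚᵘ using (mkℚᵘ)
import Data.Rational.Unnormalised.Properties as ℚᵘ
open import Data.Sum.Base using (_⊎_; inj₁; inj₂)
open import Relation.Binary.PropositionalEquality
  using (_≡_; _≢_; refl; sym; trans; cong; subst; subst₂)
open import Relation.Nullary using (¬_; yes; no)

open +-*-Solver using (solve; _:+_; _:*_; _:-_; :-_; _:=_; con)

------------------------------------------------------------------------
-- Auxiliary facts about ℚ

private
  ½-split : ∀ p → ½ * p + ½ * p ≡ p
  ½-split = solve 1 (λ p → con ½ :* p :+ con ½ :* p := p) refl

  ½-pos : ∀ {p} → 0ℚ ℚ.< p → 0ℚ ℚ.< ½ * p
  ½-pos {p} 0<p = subst (ℚ._< ½ * p) (ℚ.*-zeroʳ ½) (ℚ.*-monoʳ-<-pos ½ 0<p)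

  p≤∣p∣ : ∀ p → p ℚ.≤ ∣ p ∣
  p≤∣p∣ p with ℚ.≤-total 0ℚ p
  ... | inj₁ 0≤p = ℚ.≤-reflexive (sym (ℚ.0≤p⇒∣p∣≡p 0≤p))
  ... | inj₂ p≤0 = ℚ.≤-trans p≤0 (ℚ.0≤∣p∣ p)

  ∣p-q∣≡∣q-p∣ : ∀ p q → ∣ p - q ∣ ≡ ∣ q - p ∣
  ∣p-q∣≡∣q-p∣ p q = trans
    (cong ∣_∣ (solve 2 (λ p q → p :- q := :- (q :- p)) refl p q))
    (ℚ.∣-p∣≡∣p∣ (q - p))

  -p≤∣p∣ : ∀ p → - p ℚ.≤ ∣ p ∣
  -p≤∣p∣ p = subst (- p ℚ.≤_) (ℚ.∣-p∣≡∣p∣ p) (p≤∣p∣ (- p))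

  ∣p∣-lub : ∀ p {r} → p ℚ.≤ r → - p ℚ.≤ r → ∣ p ∣ ℚ.≤ r
  ∣p∣-lub p p≤r -p≤r with ℚ.∣p∣≡p∨∣p∣≡-p p
  ... | inj₁ eq = subst (ℚ._≤ _) (sym eq) p≤r
  ... | inj₂ eq = subst (ℚ._≤ _) (sym eq) -p≤r

  p≤r+q⇒p-q≤r : ∀ p q r → p ℚ.≤ r + q → p - q ℚ.≤ r
  p≤r+q⇒p-q≤r p q r le = subst (p - q ℚ.≤_)
    (solve 2 (λ r q → (r :+ q) :- q := r) refl r q)
    (ℚ.+-monoˡ-≤ (- q) le)

  -- A δ with B * δ = ε / 2.
  shrink : ∀ {B ε} → 0ℚ ℚ.< B → 0ℚ ℚ.< ε → ∃[ δ ] 0ℚ ℚ.< δ × B * δ ≡ ½ * ε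
  shrink {B} {ε} 0<B 0<ε = B⁻¹ * (½ * ε) , 0<δ , Bδ≡½ε
    where
    instance
      B-pos : ℚ.Positive B
      B-pos = ℚ.positive 0<B
      B-nonZero : ℚ.NonZero B
      B-nonZero = ℚ.pos⇒nonZero B
    B⁻¹ : ℚ
    B⁻¹ = 1/ B
    0<δ : 0ℚ ℚ.< B⁻¹ * (½ * ε)
    0<δ = subst (ℚ._< B⁻¹ * (½ * ε)) (ℚ.*-zeroʳ B⁻¹)
      (ℚ.*-monoʳ-<-pos B⁻¹ {{ℚ.1/pos⇒pos B}} (½-pos 0<ε))
    Bδ≡½ε : B * (B⁻¹ * (½ * ε)) ≡ ½ * ε
    Bδ≡½ε = trans (sym (ℚ.*-assoc B B⁻¹ (½ * ε)))
      (trans (cong (_* (½ * ε)) (ℚ.*-inverseʳ B)) (ℚ.*-identityˡ (½ * ε)))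

  ∣p*q∣<½ε : ∀ {B δ ε} p q → 0ℚ ℚ.< B → B * δ ≡ ½ * ε →
             ∣ p ∣ ℚ.≤ B → ∣ q ∣ ℚ.< δ → ∣ p * q ∣ ℚ.< ½ * ε
  ∣p*q∣<½ε {B} {δ} {ε} p q 0<B eq ∣p∣≤B ∣q∣<δ = begin-strict
    ∣ p * q ∣      ≡⟨ ℚ.∣p*q∣≡∣p∣*∣q∣ p q ⟩
    ∣ p ∣ * ∣ q ∣  ≤⟨ ℚ.*-monoʳ-≤-nonNeg ∣ q ∣ {{ℚ.∣-∣-nonNeg q}} ∣p∣≤B ⟩
    B * ∣ q ∣      <⟨ ℚ.*-monoʳ-<-pos B {{ℚ.positive 0<B}} ∣q∣<δ ⟩
    B * δ          ≡⟨ eq ⟩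
    ½ * ε          ∎
    where open ℚ.≤-Reasoning

  i/1-toℚᵘ : ∀ i → toℚᵘ (i / 1) ℚᵘ.≃ mkℚᵘ i 0
  i/1-toℚᵘ i = ℚ.toℚᵘ-fromℚᵘ (mkℚᵘ i 0)

  /1-mono-≤ : ∀ {i j} → i ℤ.≤ j → i / 1 ℚ.≤ j / 1
  /1-mono-≤ {i} {j} i≤j = ℚ.toℚᵘ-cancel-≤
    (ℚᵘ.≤-respˡ-≃ (ℚᵘ.≃-sym (i/1-toℚᵘ i)) (ℚᵘ.≤-respʳ-≃ (ℚᵘ.≃-sym (i/1-toℚᵘ j))
      (ℚᵘ.*≤* (ℤ.*-monoʳ-≤-nonNeg (+ 1) i≤j))))

  1+i/1 : ∀ i → ℤ.suc i / 1 ≡ 1ℚ + i / 1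
  1+i/1 i = ℚ.toℚᵘ-injective (begin
    toℚᵘ (ℤ.suc i / 1)           ≈⟨ i/1-toℚᵘ (ℤ.suc i) ⟩
    mkℚᵘ (ℤ.suc i) 0             ≈⟨ ℚᵘ.*≡* (cong (ℤ._* + 1) (cong (ℤ._+_ (+ 1)) (sym (ℤ.*-identityʳ i)))) ⟩
    mkℚᵘ (+ 1) 0 ℚᵘ.+ mkℚᵘ i 0    ≈⟨ ℚᵘ.+-congʳ (mkℚᵘ (+ 1) 0) (ℚᵘ.≃-sym (i/1-toℚᵘ i)) ⟩
    toℚᵘ 1ℚ ℚᵘ.+ toℚᵘ (i / 1)     ≈⟨ ℚᵘ.≃-sym (ℚ.toℚᵘ-homo-+ 1ℚ (i / 1)) ⟩
    toℚᵘ (1ℚ + i / 1)             ∎)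
    where open ℚᵘ.≃-Reasoning

  floor≤ : ∀ q → floor q / 1 ℚ.≤ q
  floor≤ q@record{} = ℚ.toℚᵘ-cancel-≤ (ℚᵘ.≤-respˡ-≃ (ℚᵘ.≃-sym (i/1-toℚᵘ (floor q)))
    (ℚᵘ.*≤* (subst (floor q ℤ.* ↧ q ℤ.≤_) (sym (ℤ.*-identityʳ (↥ q)))
      (ℤ.[n/d]*d≤n (↥ q) (↧ q)))))

  ≤1+floor : ∀ q → q ℚ.≤ 1ℚ + floor q / 1
  ≤1+floor q@record{} = subst (q ℚ.≤_) (1+i/1 (floor q))
    (ℚ.toℚᵘ-cancel-≤ (ℚᵘ.≤-respʳ-≃ (ℚᵘ.≃-sym (i/1-toℚᵘ (ℤ.suc (floor q))))
      (ℚᵘ.*≤* (subst₂ ℤ._≤_ (sym (ℤ.*-identityʳ (↥ q)))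
        (cong (λ i → ℤ.suc i ℤ.* ↧ q) (sym (ℤ.div-pos-is-/ℕ (↥ q) (ℚ.↧ₙ q))))
        (ℤ.<⇒≤ (ℤ.n<s[n/ℕd]*d (↥ q) (ℚ.↧ₙ q)))))))

------------------------------------------------------------------------
-- Distance from a rational to the nearest integer

frac : ℚ → ℚ
frac q = q - floor q / 1

distℤ : ℚ → ℚ
distℤ q = frac q ⊓ (1ℚ - frac q)

distℤ-attained : ∀ q → ∃[ k ] distℤ q ≡ ∣ q - k / 1 ∣
distℤ-attained q with ℚ.⊓-sel (frac q) (1ℚ - frac q)
... | inj₁ eq = floor q , trans eq (sym (ℚ.0≤p⇒∣p∣≡p 0≤frac))
  where
  0≤frac : 0ℚ ℚ.≤ frac q
  0≤frac = subst (ℚ._≤ frac q) (ℚ.+-inverseʳ (floor q / 1))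
    (ℚ.+-monoˡ-≤ (- (floor q / 1)) (floor≤ q))
... | inj₂ eq = ℤ.suc (floor q) , trans eq
  (trans (sym (ℚ.0≤p⇒∣p∣≡p 0≤1-frac))
  (trans (cong ∣_∣ rearrange)
  (trans (∣p-q∣≡∣q-p∣ (1ℚ + floor q / 1) q)
  (cong (λ r → ∣ q - r ∣) (sym (1+i/1 (floor q)))))))
  where
  rearrange : 1ℚ - frac q ≡ (1ℚ + floor q / 1) - q
  rearrange = solve 2 (λ q f → con 1ℚ :- (q :- f) := (con 1ℚ :+ f) :- q) refl q (floor q / 1)
  0≤1-frac : 0ℚ ℚ.≤ 1ℚ - frac q
  0≤1-frac = subst₂ ℚ._≤_ (ℚ.+-inverseʳ q) (sym rearrange)
    (ℚ.+-monoˡ-≤ (- q) (≤1+floor q))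

distℤ-minimal : ∀ q k → distℤ q ℚ.≤ ∣ q - k / 1 ∣
distℤ-minimal q k with k ℤ.≤? floor q
... | yes k≤⌊q⌋ = begin
    distℤ q        ≤⟨ ℚ.p⊓q≤p (frac q) (1ℚ - frac q) ⟩
    frac q         ≤⟨ ℚ.+-monoʳ-≤ q (ℚ.neg-antimono-≤ (/1-mono-≤ k≤⌊q⌋)) ⟩
    q - k / 1      ≤⟨ p≤∣p∣ (q - k / 1) ⟩
    ∣ q - k / 1 ∣  ∎
    where open ℚ.≤-Reasoning
... | no k≰⌊q⌋ = begin
    distℤ q                     ≤⟨ ℚ.p⊓q≤q (frac q) (1ℚ - frac q) ⟩
    1ℚ - frac q                 ≡⟨ solve 2 (λ q f → con 1ℚ :- (q :- f) := (con 1ℚ :+ f) :- q) refl q (floor q / 1) ⟩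
    (1ℚ + floor q / 1) - q      ≡⟨ cong (_- q) (sym (1+i/1 (floor q))) ⟩
    ℤ.suc (floor q) / 1 - q     ≤⟨ ℚ.+-monoˡ-≤ (- q) (/1-mono-≤ (ℤ.i<j⇒suc[i]≤j (ℤ.≰⇒> k≰⌊q⌋))) ⟩
    k / 1 - q                   ≤⟨ p≤∣p∣ (k / 1 - q) ⟩
    ∣ k / 1 - q ∣               ≡⟨ ∣p-q∣≡∣q-p∣ (k / 1) q ⟩
    ∣ q - k / 1 ∣               ∎
    where open ℚ.≤-Reasoning

distℤ-≤-+ : ∀ p q → distℤ p ℚ.≤ ∣ p - q ∣ + distℤ q
distℤ-≤-+ p q with distℤ-attained q
... | k , eq = begin
    distℤ p                        ≤⟨ distℤ-minimal p k ⟩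
    ∣ p - k / 1 ∣                  ≡⟨ cong ∣_∣ (solve 3 (λ p q k → p :- k := (p :- q) :+ (q :- k)) refl p q (k / 1)) ⟩
    ∣ (p - q) + (q - k / 1) ∣      ≤⟨ ℚ.∣p+q∣≤∣p∣+∣q∣ (p - q) (q - k / 1) ⟩
    ∣ p - q ∣ + ∣ q - k / 1 ∣      ≡⟨ cong (λ r → ∣ p - q ∣ + r) (sym eq) ⟩
    ∣ p - q ∣ + distℤ q            ∎
    where open ℚ.≤-Reasoning

distℤ-lipschitz : ∀ p q → ∣ distℤ p - distℤ q ∣ ℚ.≤ ∣ p - q ∣
distℤ-lipschitz p q = ∣p∣-lub (distℤ p - distℤ q)
  (p≤r+q⇒p-q≤r (distℤ p) (distℤ q) ∣ p - q ∣ (distℤ-≤-+ p q))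
  (subst (ℚ._≤ ∣ p - q ∣) (solve 2 (λ a b → b :- a := :- (a :- b)) refl (distℤ p) (distℤ q))
    (p≤r+q⇒p-q≤r (distℤ q) (distℤ p) ∣ p - q ∣
      (subst (λ r → distℤ q ℚ.≤ r + distℤ p) (∣p-q∣≡∣q-p∣ q p) (distℤ-≤-+ q p))))

------------------------------------------------------------------------
-- Real numbers, as Cauchy sequences of rationals up to _≈_

record ℝ : Set where
  constructor mkℝ
  field
    seq    : ℕ → ℚ
    cauchy : ∀ ε → 0ℚ ℚ.< ε →
             ∃[ N ] ∀ m n → N ℕ.≤ m → N ℕ.≤ n → ∣ seq m - seq n ∣ ℚ.< ε

open ℝ public

infix 4 _≈_ _≤ᴿ_ _<ᴿ_
infixl 6 _+ᴿ_
infixl 7 _*ᴿ_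

_≈_ : ℝ → ℝ → Set
x ≈ y = ∀ ε → 0ℚ ℚ.< ε → ∃[ N ] ∀ n → N ℕ.≤ n → ∣ seq x n - seq y n ∣ ℚ.< ε

_≤ᴿ_ : ℝ → ℝ → Set
x ≤ᴿ y = ∀ ε → 0ℚ ℚ.< ε → ∃[ N ] ∀ n → N ℕ.≤ n → seq x n ℚ.≤ seq y n + ε

_<ᴿ_ : ℝ → ℝ → Set
x <ᴿ y = ∃[ ε ] 0ℚ ℚ.< ε × ∃[ N ] ∀ n → N ℕ.≤ n → seq x n + ε ℚ.≤ seq y n

fromℚ : ℚ → ℝ
fromℚ q = mkℝ (λ _ → q) λ ε 0<ε → 0 , λ _ _ _ _ →
  subst (λ r → ∣ r ∣ ℚ.< ε) (sym (ℚ.+-inverseʳ q)) 0<ε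

fromℕ : ℕ → ℝ
fromℕ n = fromℚ (+ n / 1)

0ℝ : ℝ
0ℝ = fromℚ 0ℚ

_+ᴿ_ : ℝ → ℝ → ℝ
x +ᴿ y = mkℝ (λ n → seq x n + seq y n) λ ε 0<ε →
  let (M , hx) = cauchy x (½ * ε) (½-pos 0<ε)
      (N , hy) = cauchy y (½ * ε) (½-pos 0<ε)
  in M ℕ.⊔ N , λ m n le le′ →
    let a = seq x m; b = seq y m; c = seq x n; d = seq y n in begin-strict
    ∣ (a + b) - (c + d) ∣    ≡⟨ cong ∣_∣ (solve 4 (λ a b c d → (a :+ b) :- (c :+ d) := (a :- c) :+ (b :- d)) refl a b c d) ⟩
    ∣ (a - c) + (b - d) ∣    ≤⟨ ℚ.∣p+q∣≤∣p∣+∣q∣ (a - c) (b - d) ⟩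
    ∣ a - c ∣ + ∣ b - d ∣    <⟨ ℚ.+-mono-< (hx m n (ℕ.m⊔n≤o⇒m≤o M N le) (ℕ.m⊔n≤o⇒m≤o M N le′))
                                           (hy m n (ℕ.m⊔n≤o⇒n≤o M N le) (ℕ.m⊔n≤o⇒n≤o M N le′)) ⟩
    ½ * ε + ½ * ε            ≡⟨ ½-split ε ⟩
    ε                        ∎
  where open ℚ.≤-Reasoning

private
  bounded : ∀ x → ∃[ B ] 0ℚ ℚ.< B × ∃[ N ] ∀ n → N ℕ.≤ n → ∣ seq x n ∣ ℚ.≤ B
  bounded x =
    let (N , h) = cauchy x 1ℚ (ℚ.positive⁻¹ 1ℚ)
        b = seq x N
    in 1ℚ + ∣ b ∣ ,
       ℚ.<-≤-trans (ℚ.positive⁻¹ 1ℚ)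
         (subst (ℚ._≤ 1ℚ + ∣ b ∣) (ℚ.+-identityʳ 1ℚ) (ℚ.+-monoʳ-≤ 1ℚ (ℚ.0≤∣p∣ b))) ,
       N , λ n N≤n → let a = seq x n in begin
         ∣ a ∣              ≡⟨ cong ∣_∣ (solve 2 (λ a b → a := (a :- b) :+ b) refl a b) ⟩
         ∣ (a - b) + b ∣    ≤⟨ ℚ.∣p+q∣≤∣p∣+∣q∣ (a - b) b ⟩
         ∣ a - b ∣ + ∣ b ∣  ≤⟨ ℚ.+-monoˡ-≤ ∣ b ∣ (ℚ.<⇒≤ (h n N N≤n ℕ.≤-refl)) ⟩
         1ℚ + ∣ b ∣         ∎
    where open ℚ.≤-Reasoning

_*ᴿ_ : ℝ → ℝ → ℝ
x *ᴿ y = mkℝ (λ n → seq x n * seq y n) λ ε 0<ε →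
  let (B , 0<B , M₁ , bx) = bounded x
      (C , 0<C , M₂ , by) = bounded y
      (δ , 0<δ , Bδ)      = shrink 0<B 0<ε
      (η , 0<η , Cη)      = shrink 0<C 0<ε
      (N₁ , hx)           = cauchy x η 0<η
      (N₂ , hy)           = cauchy y δ 0<δ
      M = M₁ ℕ.⊔ M₂
      N = N₁ ℕ.⊔ N₂
  in M ℕ.⊔ N , λ m n le le′ →
    let a = seq x m; b = seq y m; c = seq x n; d = seq y n
        M≤m = ℕ.m⊔n≤o⇒m≤o M N le
        N≤m = ℕ.m⊔n≤o⇒n≤o M N le
        M≤n = ℕ.m⊔n≤o⇒m≤o M N le′
        N≤n = ℕ.m⊔n≤o⇒n≤o M N le′
    in begin-strict
    ∣ a * b - c * d ∣                    ≡⟨ cong ∣_∣ (solve 4 (λ a b c d → a :* b :- c :* d := a :* (b :- d) :+ d :* (a :- c)) refl a b c d) ⟩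
    ∣ a * (b - d) + d * (a - c) ∣        ≤⟨ ℚ.∣p+q∣≤∣p∣+∣q∣ (a * (b - d)) (d * (a - c)) ⟩
    ∣ a * (b - d) ∣ + ∣ d * (a - c) ∣    <⟨ ℚ.+-mono-<
      (∣p*q∣<½ε {ε = ε} a (b - d) 0<B Bδ (bx m (ℕ.m⊔n≤o⇒m≤o M₁ M₂ M≤m))
        (hy m n (ℕ.m⊔n≤o⇒n≤o N₁ N₂ N≤m) (ℕ.m⊔n≤o⇒n≤o N₁ N₂ N≤n)))
      (∣p*q∣<½ε {ε = ε} d (a - c) 0<C Cη (by n (ℕ.m⊔n≤o⇒n≤o M₁ M₂ M≤n))
        (hx m n (ℕ.m⊔n≤o⇒m≤o N₁ N₂ N≤m) (ℕ.m⊔n≤o⇒m≤o N₁ N₂ N≤n))) ⟩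
    ½ * ε + ½ * ε                        ≡⟨ ½-split ε ⟩
    ε                                    ∎
  where open ℚ.≤-Reasoning

-- Distance to the nearest integer, extended from ℚ to ℝ by continuity.  (The
-- nearest integer itself is not a computable function of a Cauchy sequence.)
‖_‖ℝ/ℤ : ℝ → ℝ
‖ x ‖ℝ/ℤ = mkℝ (λ n → distℤ (seq x n)) λ ε 0<ε →
  let (N , h) = cauchy x ε 0<ε
  in N , λ m n le le′ →
    ℚ.≤-<-trans (distℤ-lipschitz (seq x m) (seq x n)) (h m n le le′)

------------------------------------------------------------------------
-- Real polynomials, as coefficient lists with the constant term first;
-- trailing zero coefficients are allowed.

Poly : Set
Poly = List ℝ

coeff : Poly → ℕ → ℝ
coeff []      _       = 0ℝ
coeff (a ∷ p) zero    = a
coeff (a ∷ p) (suc j) = coeff p j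

eval : Poly → ℝ → ℝ
eval []      x = 0ℝ
eval (a ∷ p) x = a +ᴿ x *ᴿ eval p x

HasDegree : Poly → ℕ → Set
HasDegree p d = ¬ (coeff p d ≈ 0ℝ) × (∀ j → d ℕ.< j → coeff p j ≈ 0ℝ)

------------------------------------------------------------------------
-- Finite sets of positive integers, listed in increasing order

record FinSet⁺ : Set where
  field
    elements   : List ℕ
    increasing : Linked ℕ._<_ elements
    positive   : All (1 ℕ.≤_) elements

open FinSet⁺ public

maximum : FinSet⁺ → ℕ
maximum α = max 0 (elements α)

∑[_]_ : FinSet⁺ → (ℕ → ℕ) → ℕ
∑[ α ] n = sum (map n (elements α))

𝒮 : ℕ → FinSet⁺ → Set
𝒮 k α = elements α ≢ [] ×
  (∀ i → i ∈ elements α →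
    i ≡ maximum α ⊎ (∃[ j ] j ∈ elements α × i ℕ.< j × j ℕ.≤ i ℕ.+ k))

{-# OPTIONS --safe #-}

-- Split ℕ into the d residue classes ("tracks") mod d.  A word of events "switch track c on/off",
-- executed at times t₁ < t₂ < …, describes a set of integers; its gaps are at most d as soon as some
-- track survives each event.  If S c t is the sum of the n i over the i of track c after time t, the
-- sum over the set is Σ ± S c t, one term per event.
--
-- By Ramsey's theorem the iterated differences of p in the directions S c t may be assumed to depend,
-- up to a small error mod 1, only on the order of the tracks involved.  The value of p at the sum is
-- then a linear functional of the word, and the events act on functionals by unipotent operators A c
-- (on) and B c (off) for which A c − 1 lowers the degree by one and B c · A c − 1 by two.  Starting from
-- B₀ · A₀, taking commutators with the remaining d − 1 tracks gives a word that acts trivially in degree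
-- d.  All of its factors but one have another track switched on, so solving for the exceptional factor
-- writes the identity as a covering word.  Inverses are not available, but vʳ⁻¹ is an inverse of v at
-- r = 0; the value along the resulting word is a polynomial in r that vanishes at r = 0, hence is close to
-- an integer for some r ≥ 1 by polynomial recurrence.  All bounds are independent of p, so that p may be
-- replaced by a rational approximation.
module Submission where

open import Defs
open import Data.Bool.Base as Bool using (Bool; true; false; if_then_else_; _∧_)
import Data.Bool.Properties as Bool
open import Data.Fin.Base as Fin
  using (Fin; zero; suc; toℕ; fromℕ<; combine; remQuot; funToFin; finToFun)
import Data.Fin.Properties as Fin
open import Data.Integer.Base as ℤ using (ℤ; +_; _%ℕ_; _/ℕ_)
import Data.Integer.DivMod as ℤ
import Data.Integer.Properties as ℤ
import Data.Integer.Solver as ℤSolver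
open import Data.List.Base as List
  using (List; []; _∷_; length; _++_; map; take; cartesianProductWith; allFin; upTo; filter)
open import Data.List.Extrema.Nat using (argmax-sel; xs≤max)
open import Data.List.Membership.Propositional using (_∈_)
open import Data.List.Membership.Propositional.Properties
  using (∈-lookup; ∈-cartesianProductWith⁺; ∈-++⁺ˡ; ∈-++⁺ʳ; ∈-map⁺; ∈-map⁻; ∈-allFin;
         ∈-filter⁺; ∈-filter⁻; ∈-upTo⁺; ∈-upTo⁻)
import Data.List.Properties as List
open import Data.List.Relation.Binary.Sublist.Propositional
  using (_⊆_; []; _∷_; _∷ʳ_; ⊆-refl; ⊆-trans; minimum)
import Data.List.Relation.Binary.Sublist.Heterogeneous.Properties as Sublist
open import Data.List.Relation.Binary.Sublist.Propositional.Properties using (All-resp-⊆; map⁺)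
open import Data.List.Relation.Unary.All as All using (All; []; _∷_)
import Data.List.Relation.Unary.All.Properties as All
open import Data.List.Relation.Unary.AllPairs as AllPairs using (AllPairs; []; _∷_)
import Data.List.Relation.Unary.AllPairs.Properties as AllPairs
open import Data.List.Relation.Unary.Any using (here; there)
open import Data.List.Relation.Unary.Linked.Properties using (AllPairs⇒Linked)
open import Data.List.Relation.Unary.Unique.Propositional using (Unique)
open import Data.Nat.Base as ℕ using (ℕ; zero; suc; _∸_; _^_; _≤_; _≤ᵇ_)
open import Data.Nat.DivMod
  using (_mod_; m≡m%n+[m/n]*n; [m+kn]%n≡m%n; m<n⇒m%n≡m; m*n/n≡m; m<n⇒m/n≡0;
         +-distrib-/-∣ʳ; m%n<n; m<n*o⇒m/o<n)
open import Data.Nat.Divisibility using (divides-refl)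
open import Data.Nat.ListAction using (sum)
import Data.Nat.Properties as ℕ
open import Data.Product using (_×_; _,_; ∃-syntax; proj₁; proj₂)
open import Data.Rational.Base as ℚ
  using (ℚ; 0ℚ; 1ℚ; ½; _+_; _*_; _-_; -_; ∣_∣; _/_; toℚᵘ; ↥_; ↧_; ↧ₙ_)
import Data.Rational.Properties as ℚ
open import Data.Rational.Solver using (module +-*-Solver)
open import Data.Rational.Unnormalised.Base as ℚᵘ using (mkℚᵘ)
import Data.Rational.Unnormalised.Properties as ℚᵘ
open import Data.Sum.Base using (_⊎_; inj₁; inj₂)
open import Data.Unit.Base using (⊤; tt)
open import Function.Base using (_∘_; id)
open import Relation.Binary.Definitions using (tri<; tri≈; tri>)
open import Relation.Binary.PropositionalEquality
open import Relation.Nullary using (yes; no; does; contradiction)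
open import Relation.Nullary.Decidable using (dec-true; dec-false)
open +-*-Solver using (solve; _:+_; _:*_; _:-_; :-_; _:=_; con)
module ℤS = ℤSolver.+-*-Solver

-- Distance to the integers on ℚ

∣p∣≤ : ∀ {r} p → p ℚ.≤ r → - p ℚ.≤ r → ∣ p ∣ ℚ.≤ r
∣p∣≤ p p≤r -p≤r with ℚ.∣p∣≡p∨∣p∣≡-p p
... | inj₁ eq = subst (ℚ._≤ _) (sym eq) p≤r
... | inj₂ eq = subst (ℚ._≤ _) (sym eq) -p≤r

i/1≃i : ∀ i → toℚᵘ (i / 1) ℚᵘ.≃ mkℚᵘ i 0
i/1≃i i = ℚ.toℚᵘ-fromℚᵘ (mkℚᵘ i 0)

i≤∣i∣ : ∀ i → i ℤ.≤ + ℤ.∣ i ∣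
i≤∣i∣ (+ n)      = ℤ.≤-refl
i≤∣i∣ ℤ.-[1+ n ] = ℤ.-≤+

/1-homo-+ : ∀ i j → (i ℤ.+ j) / 1 ≡ i / 1 + j / 1
/1-homo-+ i j = ℚ.toℚᵘ-injective (begin
  toℚᵘ ((i ℤ.+ j) / 1)               ≈⟨ i/1≃i (i ℤ.+ j) ⟩
  mkℚᵘ (i ℤ.+ j) 0                   ≈⟨ ℚᵘ.*≡* (cong (ℤ._* + 1) (sym (cong₂ ℤ._+_ (ℤ.*-identityʳ i) (ℤ.*-identityʳ j)))) ⟩
  mkℚᵘ i 0 ℚᵘ.+ mkℚᵘ j 0             ≈⟨ ℚᵘ.+-cong (i/1≃i i) (i/1≃i j) ⟨
  toℚᵘ (i / 1) ℚᵘ.+ toℚᵘ (j / 1)     ≈⟨ ℚ.toℚᵘ-homo-+ (i / 1) (j / 1) ⟨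
  toℚᵘ (i / 1 + j / 1)               ∎)
  where open ℚᵘ.≃-Reasoning

/1-homo-* : ∀ i j → (i ℤ.* j) / 1 ≡ i / 1 * (j / 1)
/1-homo-* i j = ℚ.toℚᵘ-injective (begin
  toℚᵘ ((i ℤ.* j) / 1)               ≈⟨ i/1≃i (i ℤ.* j) ⟩
  mkℚᵘ (i ℤ.* j) 0                   ≈⟨ ℚᵘ.≃-refl ⟩
  mkℚᵘ i 0 ℚᵘ.* mkℚᵘ j 0             ≈⟨ ℚᵘ.*-cong (i/1≃i i) (i/1≃i j) ⟨
  toℚᵘ (i / 1) ℚᵘ.* toℚᵘ (j / 1)     ≈⟨ ℚ.toℚᵘ-homo-* (i / 1) (j / 1) ⟨
  toℚᵘ (i / 1 * (j / 1))             ∎)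
  where open ℚᵘ.≃-Reasoning

/1-homo-neg : ∀ i → (ℤ.- i) / 1 ≡ - (i / 1)
/1-homo-neg i = ℚ.toℚᵘ-injective (begin
  toℚᵘ ((ℤ.- i) / 1)     ≈⟨ i/1≃i (ℤ.- i) ⟩
  ℚᵘ.- mkℚᵘ i 0          ≈⟨ ℚᵘ.-‿cong (i/1≃i i) ⟨
  ℚᵘ.- toℚᵘ (i / 1)      ≈⟨ ℚ.toℚᵘ-homo‿- (i / 1) ⟨
  toℚᵘ (- (i / 1))       ∎)
  where open ℚᵘ.≃-Reasoning

/1-mono-≤ : ∀ {i j} → i ℤ.≤ j → i / 1 ℚ.≤ j / 1
/1-mono-≤ {i} {j} i≤j = ℚ.toℚᵘ-cancel-≤
  (ℚᵘ.≤-respˡ-≃ (ℚᵘ.≃-sym (i/1≃i i)) (ℚᵘ.≤-respʳ-≃ (ℚᵘ.≃-sym (i/1≃i j))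
    (ℚᵘ.*≤* (ℤ.*-monoʳ-≤-nonNeg (+ 1) i≤j))))

-- The nearby integer is kept as data, so that errors modulo 1 add up by adding centres, without
-- case distinctions on `distℤ`.
record Near (ε x : ℚ) : Set where
  constructor near
  field
    centre : ℤ
    close  : ∣ x - centre / 1 ∣ ℚ.≤ ε

Near⇒distℤ≤ : ∀ {ε x} → Near ε x → distℤ x ℚ.≤ ε
Near⇒distℤ≤ {x = x} (near k le) = ℚ.≤-trans (distℤ-minimal x k) le

Near-∣∣ : ∀ {x ε} → ∣ x ∣ ℚ.≤ ε → Near ε x
Near-∣∣ {x} {ε} le = near (+ 0) (subst (λ z → ∣ z ∣ ℚ.≤ ε) (sym (ℚ.+-identityʳ x)) le)

Near-+ : ∀ {ε x ε′ y} → Near ε x → Near ε′ y → Near (ε + ε′) (x + y)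
Near-+ {ε} {x} {ε′} {y} (near k p) (near l q) = near (k ℤ.+ l) (begin
  ∣ (x + y) - (k ℤ.+ l) / 1 ∣          ≡⟨ cong (λ z → ∣ (x + y) - z ∣) (/1-homo-+ k l) ⟩
  ∣ (x + y) - (k / 1 + l / 1) ∣        ≡⟨ cong ∣_∣ (solve 4 (λ x y k l → (x :+ y) :- (k :+ l) := (x :- k) :+ (y :- l)) refl x y (k / 1) (l / 1)) ⟩
  ∣ (x - k / 1) + (y - l / 1) ∣        ≤⟨ ℚ.∣p+q∣≤∣p∣+∣q∣ (x - k / 1) (y - l / 1) ⟩
  ∣ x - k / 1 ∣ + ∣ y - l / 1 ∣        ≤⟨ ℚ.+-mono-≤ p q ⟩
  ε + ε′                                ∎)
  where open ℚ.≤-Reasoning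

Near-neg : ∀ {ε x} → Near ε x → Near ε (- x)
Near-neg {ε} {x} (near k p) = near (ℤ.- k) (subst (ℚ._≤ ε) eq p)
  where
  eq : ∣ x - k / 1 ∣ ≡ ∣ - x - (ℤ.- k) / 1 ∣
  eq = trans (sym (ℚ.∣-p∣≡∣p∣ (x - k / 1))) (cong ∣_∣
    (trans (solve 2 (λ x k → :- (x :- k) := :- x :- :- k) refl x (k / 1))
           (cong (λ z → - x - z) (sym (/1-homo-neg k)))))

Near-- : ∀ {ε x ε′ y} → Near ε x → Near ε′ y → Near (ε + ε′) (x - y)
Near-- p q = Near-+ p (Near-neg q)

Near-mono : ∀ {ε ε′ x} → ε ℚ.≤ ε′ → Near ε x → Near ε′ x
Near-mono le (near k p) = near k (ℚ.≤-trans p le)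

⌊_⌋-spec : ∀ q → ∃[ i ] i / 1 ℚ.≤ q × q ℚ.≤ 1ℚ + i / 1
⌊ q@record{} ⌋-spec = i ,
  ℚ.toℚᵘ-cancel-≤ (ℚᵘ.≤-respˡ-≃ (ℚᵘ.≃-sym (i/1≃i i))
    (ℚᵘ.*≤* (subst (i ℤ.* ↧ q ℤ.≤_) (sym (ℤ.*-identityʳ (↥ q)))
      (ℤ.[n/ℕd]*d≤n (↥ q) (↧ₙ q))))) ,
  subst (q ℚ.≤_) (/1-homo-+ (+ 1) i)
    (ℚ.toℚᵘ-cancel-≤ (ℚᵘ.≤-respʳ-≃ (ℚᵘ.≃-sym (i/1≃i (ℤ.suc i)))
      (ℚᵘ.*≤* (subst (ℤ._≤ ℤ.suc i ℤ.* ↧ q) (sym (ℤ.*-identityʳ (↥ q)))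
        (ℤ.<⇒≤ (ℤ.n<s[n/ℕd]*d (↥ q) (↧ₙ q)))))))
  where
  i = ↥ q /ℕ ↧ₙ q

-- Rounding modulo 1

≡%⇒≡+* : ∀ i j m .{{_ : ℕ.NonZero m}} → i %ℕ m ≡ j %ℕ m →
         i ℤ.- j ≡ + m ℤ.* (i /ℕ m ℤ.- j /ℕ m)
≡%⇒≡+* i j m eq = begin
  i ℤ.- j                                                ≡⟨ cong₂ ℤ._-_ (ℤ.a≡a%ℕn+[a/ℕn]*n i m) (ℤ.a≡a%ℕn+[a/ℕn]*n j m) ⟩
  (+ (i %ℕ m) ℤ.+ a ℤ.* + m) ℤ.- (+ (j %ℕ m) ℤ.+ b ℤ.* + m)  ≡⟨ cong (λ z → (+ z ℤ.+ a ℤ.* + m) ℤ.- (+ (j %ℕ m) ℤ.+ b ℤ.* + m)) eq ⟩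
  (+ (j %ℕ m) ℤ.+ a ℤ.* + m) ℤ.- (+ (j %ℕ m) ℤ.+ b ℤ.* + m)  ≡⟨ ℤS.solve 4 (λ r a b m → (r ℤS.:+ a ℤS.:* m) ℤS.:- (r ℤS.:+ b ℤS.:* m) ℤS.:= m ℤS.:* (a ℤS.:- b)) refl (+ (j %ℕ m)) a b (+ m) ⟩
  + m ℤ.* (a ℤ.- b)                                      ∎
  where
  open ≡-Reasoning
  a = i /ℕ m
  b = j /ℕ m

-- The circle of reals modulo 1 is cut into `m` arcs of length 1/m; the value is the index of the
-- arc that contains `q`.
quantise : ∀ m .{{_ : ℕ.NonZero m}} → ℚ → Fin m
quantise m q = fromℕ< (ℤ.n%ℕd<d (proj₁ ⌊ q * (+ m / 1) ⌋-spec) m)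

-- Floors of `X` and `Y` with equal residues differ by a multiple of `m`, which becomes an integer
-- after division by `m`; what remains of `X - Y` is at most 1 and becomes `δ`.
quantise-≡ : ∀ x y m .{{_ : ℕ.NonZero m}} {δ} → 0ℚ ℚ.≤ δ → δ * (+ m / 1) ≡ 1ℚ →
             quantise m x ≡ quantise m y → Near δ (x - y)
quantise-≡ x y m {δ} 0≤δ δm eq = near k (begin
  ∣ (x - y) - k / 1 ∣              ≡⟨ cong ∣_∣ scale ⟩
  ∣ δ * ((X - Y) - (i / 1 - j / 1)) ∣   ≡⟨ ℚ.∣p*q∣≡∣p∣*∣q∣ δ ((X - Y) - (i / 1 - j / 1)) ⟩
  ∣ δ ∣ * ∣ (X - Y) - (i / 1 - j / 1) ∣ ≤⟨ ℚ.*-monoˡ-≤-nonNeg ∣ δ ∣ {{ℚ.∣-∣-nonNeg δ}} bound ⟩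
  ∣ δ ∣ * 1ℚ                         ≡⟨ ℚ.*-identityʳ ∣ δ ∣ ⟩
  ∣ δ ∣                              ≡⟨ ℚ.0≤p⇒∣p∣≡p 0≤δ ⟩
  δ                                  ∎)
  where
  open ℚ.≤-Reasoning
  M = + m / 1
  X = x * M
  Y = y * M
  i = proj₁ ⌊ X ⌋-spec
  j = proj₁ ⌊ Y ⌋-spec
  k = i /ℕ m ℤ.- j /ℕ m
  i-j : i / 1 - j / 1 ≡ M * (k / 1)
  i-j = trans (cong (λ z → i / 1 + z) (sym (/1-homo-neg j))) (trans (sym (/1-homo-+ i (ℤ.- j)))
    (trans (cong (_/ 1) (≡%⇒≡+* i j m (Fin.fromℕ<-injective _ _ (ℤ.n%ℕd<d i m) (ℤ.n%ℕd<d j m) eq))) (/1-homo-* (+ m) k)))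
  scale : (x - y) - k / 1 ≡ δ * ((X - Y) - (i / 1 - j / 1))
  scale = trans (sym (ℚ.*-identityˡ _)) (trans (cong (_* ((x - y) - k / 1)) (sym δm))
    (trans (solve 5 (λ δ m x y k → (δ :* m) :* ((x :- y) :- k) := δ :* ((x :* m :- y :* m) :- m :* k)) refl δ M x y (k / 1))
      (cong (λ z → δ * ((X - Y) - z)) (sym i-j))))
  bound : ∣ (X - Y) - (i / 1 - j / 1) ∣ ℚ.≤ 1ℚ
  bound = ∣p∣≤ _
    (begin
      (X - Y) - (i / 1 - j / 1)  ≤⟨ ℚ.+-monoˡ-≤ (- (i / 1 - j / 1)) (ℚ.+-mono-≤ (proj₂ (proj₂ ⌊ X ⌋-spec)) (ℚ.neg-antimono-≤ (proj₁ (proj₂ ⌊ Y ⌋-spec)))) ⟩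
      ((1ℚ + i / 1) - j / 1) - (i / 1 - j / 1) ≡⟨ solve 2 (λ i j → ((con 1ℚ :+ i) :- j) :- (i :- j) := con 1ℚ) refl (i / 1) (j / 1) ⟩
      1ℚ ∎)
    (begin
      - ((X - Y) - (i / 1 - j / 1)) ≡⟨ solve 4 (λ X Y i j → :- ((X :- Y) :- (i :- j)) := (Y :- X) :+ (i :- j)) refl X Y (i / 1) (j / 1) ⟩
      (Y - X) + (i / 1 - j / 1)  ≤⟨ ℚ.+-monoˡ-≤ (i / 1 - j / 1) (ℚ.+-mono-≤ (proj₂ (proj₂ ⌊ Y ⌋-spec)) (ℚ.neg-antimono-≤ (proj₁ (proj₂ ⌊ X ⌋-spec)))) ⟩
      ((1ℚ + j / 1) - i / 1) + (i / 1 - j / 1) ≡⟨ solve 2 (λ i j → ((con 1ℚ :+ j) :- i) :+ (i :- j) := con 1ℚ) refl (i / 1) (j / 1) ⟩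
      1ℚ ∎)

boxes : ∀ {ε} → 0ℚ ℚ.< ε → ∃[ m ] ∃[ δ ] 0ℚ ℚ.≤ δ × δ ℚ.≤ ε × δ * (+ suc m / 1) ≡ 1ℚ
boxes {ε} 0<ε = m , δ , 0≤δ , δ≤ε , ℚ.*-inverseˡ M
  where
  instance
    ε-pos : ℚ.Positive ε
    ε-pos = ℚ.positive 0<ε
    ε-nz : ℚ.NonZero ε
    ε-nz = ℚ.pos⇒nonZero ε
  i = proj₁ ⌊ ℚ.1/ ε ⌋-spec
  m = ℤ.∣ i ∣
  M = + suc m / 1
  M-pos : ℚ.Positive M
  M-pos = ℚ.positive (ℚ.<-≤-trans (ℚ.positive⁻¹ 1ℚ) (/1-mono-≤ {+ 1} {+ suc m} (ℤ.+≤+ (ℕ.s≤s ℕ.z≤n))))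
  instance
    M-pos′ : ℚ.Positive M
    M-pos′ = M-pos
    M-nz : ℚ.NonZero M
    M-nz = ℚ.pos⇒nonZero M
  δ : ℚ
  δ = ℚ.1/ M
  0≤δ : 0ℚ ℚ.≤ δ
  0≤δ = ℚ.<⇒≤ (ℚ.positive⁻¹ δ {{ℚ.1/pos⇒pos M}})
  1/ε≤M : ℚ.1/ ε ℚ.≤ M
  1/ε≤M = ℚ.≤-trans (proj₂ (proj₂ ⌊ ℚ.1/ ε ⌋-spec))
    (subst (ℚ._≤ M) (/1-homo-+ (+ 1) i) (/1-mono-≤ (ℤ.+-monoʳ-≤ (+ 1) (i≤∣i∣ i))))
  open ℚ.≤-Reasoning
  δ≤ε : δ ℚ.≤ ε
  δ≤ε = begin
    δ                    ≡⟨ ℚ.*-identityʳ δ ⟨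
    δ * 1ℚ               ≡⟨ cong (δ *_) (ℚ.*-inverseˡ ε) ⟨
    δ * (ℚ.1/ ε * ε)     ≤⟨ ℚ.*-monoˡ-≤-nonNeg δ {{ℚ.nonNegative 0≤δ}} (ℚ.*-monoʳ-≤-nonNeg ε {{ℚ.pos⇒nonNeg ε}} 1/ε≤M) ⟩
    δ * (M * ε)          ≡⟨ ℚ.*-assoc δ M ε ⟨
    δ * M * ε            ≡⟨ cong (_* ε) (ℚ.*-inverseˡ M) ⟩
    1ℚ * ε               ≡⟨ ℚ.*-identityˡ ε ⟩
    ε                    ∎

-- Finite differences and polynomial recurrence

½-split : ∀ p → ½ * p + ½ * p ≡ p
½-split = solve 1 (λ p → con ½ :* p :+ con ½ :* p := p) refl

½-pos : ∀ {ε} → 0ℚ ℚ.< ε → 0ℚ ℚ.< ½ * ε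
½-pos {ε} 0<ε = subst (ℚ._< ½ * ε) (ℚ.*-zeroʳ ½) (ℚ.*-monoʳ-<-pos ½ 0<ε)

-- Degrees are measured by iterated differences. Two actions occur: the successor on ℕ, for the
-- dependence on the exponent `r`, and all translations of ℚ, for the polynomial itself.
module Degree {M H : Set} (_▹_ : H → M → M) where

  Deg< : ℕ → (M → ℚ) → Set
  Deg< zero    f = ∀ x → f x ≡ 0ℚ
  Deg< (suc n) f = ∀ h → Deg< n (λ x → f (h ▹ x) - f x)

  Deg<-cong : ∀ n {f g} → (∀ x → f x ≡ g x) → Deg< n f → Deg< n g
  Deg<-cong zero    f≗g df x = trans (sym (f≗g x)) (df x)
  Deg<-cong (suc n) f≗g df h = Deg<-cong n (λ x → cong₂ _-_ (f≗g (h ▹ x)) (f≗g x)) (df h)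

  Deg<-0 : ∀ n {f} → (∀ x → f x ≡ 0ℚ) → Deg< n f
  Deg<-0 zero    f≗0 = f≗0
  Deg<-0 (suc n) f≗0 h = Deg<-0 n (λ x → cong₂ _-_ (f≗0 (h ▹ x)) (f≗0 x))

  Deg<-+ : ∀ n {f g} → Deg< n f → Deg< n g → Deg< n (λ x → f x + g x)
  Deg<-+ zero    df dg x = cong₂ _+_ (df x) (dg x)
  Deg<-+ (suc n) {f} {g} df dg h = Deg<-cong n
    (λ x → solve 4 (λ a b c d → (a :- b) :+ (c :- d) := (a :+ c) :- (b :+ d)) refl (f (h ▹ x)) (f x) (g (h ▹ x)) (g x))
    (Deg<-+ n (df h) (dg h))

  Deg<-* : ∀ n {f} c → Deg< n f → Deg< n (λ x → c * f x)
  Deg<-* zero    c df x = trans (cong (c *_) (df x)) (ℚ.*-zeroʳ c)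
  Deg<-* (suc n) {f} c df h = Deg<-cong n
    (λ x → solve 3 (λ c a b → c :* (a :- b) := c :* a :- c :* b) refl c (f (h ▹ x)) (f x))
    (Deg<-* n c (df h))

  Deg<-- : ∀ n {f g} → Deg< n f → Deg< n g → Deg< n (λ x → f x - g x)
  Deg<-- n {f} {g} df dg = Deg<-cong n
    (λ x → solve 2 (λ a b → a :+ con (- 1ℚ) :* b := a :- b) refl (f x) (g x))
    (Deg<-+ n df (Deg<-* n (- 1ℚ) dg))

  Deg<-suc : ∀ n {f} → Deg< n f → Deg< (suc n) f
  Deg<-suc zero    df h = λ x → cong₂ _-_ (df (h ▹ x)) (df x)
  Deg<-suc (suc n) df h = Deg<-suc n (df h)

  Deg<-mono : ∀ {m n f} → m ℕ.≤ n → Deg< m f → Deg< n f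
  Deg<-mono {n = n} ℕ.z≤n       df = Deg<-0 n df
  Deg<-mono         (ℕ.s≤s m≤n) df h = Deg<-mono m≤n (df h)

  Deg<-const : ∀ n c → Deg< (suc n) (λ _ → c)
  Deg<-const n c h = Deg<-0 n (λ _ → ℚ.+-inverseʳ c)

  Deg<-shift : ∀ n {f} (g : M → M) → (∀ h x → g (h ▹ x) ≡ h ▹ g x) →
               Deg< n f → Deg< n (f ∘ g)
  Deg<-shift zero    g comm df x = df (g x)
  Deg<-shift (suc n) {f} g comm df h = Deg<-cong n
    (λ x → cong (λ y → f y - f (g x)) (sym (comm h x)))
    (Deg<-shift n g comm (df h))

open Degree {ℕ} {⊤} (λ _ → suc) public

Deg<-shift-+ : ∀ n {f} z → Deg< n f → Deg< n (λ r → f (z ℕ.+ r))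
Deg<-shift-+ n z = Deg<-shift n (z ℕ.+_) (λ _ → ℕ.+-suc z)

-- The shift by `z` is a telescoping sum of `z` unit differences.
Deg<-Δ : ∀ n {f} z → Deg< (suc n) f → Deg< n (λ r → f (z ℕ.+ r) - f r)
Deg<-Δ n {f} zero    df = Deg<-0 n (λ r → ℚ.+-inverseʳ (f r))
Deg<-Δ n {f} (suc z) df = Deg<-cong n
  (λ r → solve 3 (λ a b c → (a :- b) :+ (b :- c) := a :- c) refl (f (suc (z ℕ.+ r))) (f (z ℕ.+ r)) (f r))
  (Deg<-+ n (Deg<-shift-+ n z (df tt)) (Deg<-Δ n {f} z df))

-- Simultaneous polynomial recurrence with uniform bounds

AllPairs-lookup : ∀ {A : Set} {R : A → A → Set} {xs} → AllPairs R xs →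
                  ∀ {i j} → i Fin.< j → R (List.lookup xs i) (List.lookup xs j)
AllPairs-lookup {xs = _ ∷ xs} (rs ∷ _) {zero}  {suc j} _           = All.lookup rs (∈-lookup j)
AllPairs-lookup (_ ∷ ps) {suc i} {suc j} (ℕ.s≤s i<j) = AllPairs-lookup ps i<j

Vanishing : ℕ → (ℕ → ℚ) → Set
Vanishing D Q = Deg< (suc D) Q × Q 0 ≡ 0ℚ

-- The bound `R` is chosen before the polynomials. Hence the induction can treat all defect
-- polynomials of a chain at once, and the covering words have bounded length before `P` is known.
Recurrence : ℕ → Set
Recurrence D = ∀ s ε → 0ℚ ℚ.< ε → ∃[ R ] ∀ (Q : Fin s → ℕ → ℚ) → (∀ a → Vanishing D (Q a)) →
  ∃[ r ] 1 ℕ.≤ r × r ℕ.≤ R × ∀ a → Near ε (Q a r)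

-- Chains are listed from the top.
module _ {s} (Q : Fin s → ℕ → ℚ) where

  AlmostAdditive : ℚ → ℕ → ℕ → Set
  AlmostAdditive ε x y = ∀ a → Near ε (Q a (x ∸ y) - (Q a x - Q a y))

  record Chain (ε : ℚ) (M X : ℕ) : Set where
    field
      top      : ℕ
      rest     : List ℕ
      size     : length rest ≡ M
      bounded  : top ℕ.≤ X
      decr     : AllPairs ℕ._>_ (top ∷ rest)
      additive : AllPairs (AlmostAdditive ε) (top ∷ rest)

module _ {D} (rec : Recurrence D) where

  -- The additivity defect is a difference of `Q` minus a constant, so it has one degree less; this
  -- drives the induction on the degree.
  defect-Vanishing : ∀ Q z → Vanishing (suc D) Q →
                     Vanishing D (λ r → Q (z ℕ.+ r) - Q r - Q z)
  defect-Vanishing Q z (dQ , Q0) =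
    Deg<-- (suc D) {λ r → Q (z ℕ.+ r) - Q r} (Deg<-Δ (suc D) {Q} z dQ) (Deg<-const D (Q z)) ,
    trans (cong₂ (λ a b → Q a - b - Q z) (ℕ.+-identityʳ z) Q0)
          (solve 1 (λ q → (q :- con 0ℚ) :- q := con 0ℚ) refl (Q z))

  -- A chain with top `h` is extended by `h + r`, where recurrence in lower degree makes the defects
  -- at `r` against all `z ≤ X` small. Then `Q (h + r - y)` and `Q (h + r)` both gain nearly `Q r`,
  -- so additivity passes from the pair `h, y` to `h + r, y`.
  chain : ∀ s ε → 0ℚ ℚ.< ε → ∀ M →
          ∃[ X ] ∀ (Q : Fin s → ℕ → ℚ) → (∀ a → Vanishing (suc D) (Q a)) → Chain Q ε M X
  chain s ε 0<ε zero = 0 , λ Q vQ → record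
    { top = 0 ; rest = [] ; size = refl ; bounded = ℕ.z≤n
    ; decr = [] ∷ [] ; additive = [] ∷ [] }
  chain s ε 0<ε (suc M) = X ℕ.+ R , extend
    where
    0<½ε = ½-pos 0<ε
    -- Two defects of size `η` and the old error `½ * ε` sum to `ε`.
    η = ½ * (½ * ε)
    X = proj₁ (chain s (½ * ε) 0<½ε M)
    R = proj₁ (rec (s ℕ.* suc X) η (½-pos 0<½ε))
    extend : ∀ (Q : Fin s → ℕ → ℚ) → (∀ a → Vanishing (suc D) (Q a)) → Chain Q ε (suc M) (X ℕ.+ R)
    extend Q vQ = record
      { top = h ℕ.+ r
      ; rest = h ∷ rest
      ; size = cong suc size
      ; bounded = ℕ.+-mono-≤ bounded r≤R
      ; decr = (h<h+r ∷ All.map (λ lt → ℕ.<-trans lt h<h+r) (AllPairs.head decr)) ∷ decr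
      ; additive = (new ℕ.≤-refl diag ∷
                     All.zipWith (λ { (lt , p) → new (ℕ.<⇒≤ lt) p })
                       (AllPairs.head decr , AllPairs.head additive))
                   ∷ AllPairs.map (λ p a → Near-mono ½ε≤ε (p a)) additive
      }
      where
      open Chain (proj₂ (chain s (½ * ε) 0<½ε M) Q vQ) renaming (top to h)
      Q′ : Fin (s ℕ.* suc X) → ℕ → ℚ
      Q′ i r = let (a , z) = remQuot (suc X) i in Q a (toℕ z ℕ.+ r) - Q a r - Q a (toℕ z)
      step = proj₂ (rec (s ℕ.* suc X) η (½-pos 0<½ε)) Q′
        (λ i → let (a , z) = remQuot (suc X) i in defect-Vanishing (Q a) (toℕ z) (vQ a))
      r = proj₁ step
      r≤R = proj₁ (proj₂ (proj₂ step))
      h<h+r : h ℕ.< h ℕ.+ r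
      h<h+r = ℕ.m<m+n h (proj₁ (proj₂ step))
      small : ∀ a z → z ℕ.≤ X → Near η (Q a (z ℕ.+ r) - Q a r - Q a z)
      small a z z≤X = subst (λ z → Near η (Q a (z ℕ.+ r) - Q a r - Q a z)) (Fin.toℕ-fromℕ< (ℕ.s≤s z≤X))
        (subst (λ (a , z) → Near η (Q a (toℕ z ℕ.+ r) - Q a r - Q a (toℕ z)))
          (Fin.remQuot-combine a (fromℕ< (ℕ.s≤s z≤X)))
          (proj₂ (proj₂ (proj₂ step)) (combine a (fromℕ< (ℕ.s≤s z≤X)))))
      ½ε≤ε : ½ * ε ℚ.≤ ε
      ½ε≤ε = begin
        ½ * ε              ≡⟨ ℚ.+-identityʳ (½ * ε) ⟨
        ½ * ε + 0ℚ         ≤⟨ ℚ.+-monoʳ-≤ (½ * ε) (ℚ.<⇒≤ 0<½ε) ⟩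
        ½ * ε + ½ * ε      ≡⟨ ½-split ε ⟩
        ε                  ∎
        where open ℚ.≤-Reasoning
      -- This plays the part of the old pair when the former top itself is compared with `h + r`.
      diag : AlmostAdditive Q (½ * ε) h h
      diag a = Near-∣∣ (subst (ℚ._≤ ½ * ε) (sym (cong ∣_∣
        (cong₂ _-_ (trans (cong (Q a) (ℕ.n∸n≡0 h)) (proj₂ (vQ a))) (ℚ.+-inverseʳ (Q a h)))))
        (ℚ.<⇒≤ 0<½ε))
      new : ∀ {y} → y ℕ.≤ h → AlmostAdditive Q (½ * ε) h y → AlmostAdditive Q ε (h ℕ.+ r) y
      new {y} y≤h p a = subst₂ Near
        (trans (cong (_+ ½ * ε) (½-split (½ * ε))) (½-split ε))
        (trans (solve 6 (λ w r z t h y → (((w :- r) :- z) :- ((t :- r) :- h)) :+ (z :- (h :- y)) := w :- (t :- y))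
                  refl (Q a ((h ∸ y) ℕ.+ r)) (Q a r) (Q a (h ∸ y)) (Q a (h ℕ.+ r)) (Q a h) (Q a y))
               (cong (λ w → Q a w - (Q a (h ℕ.+ r) - Q a y)) (sym (ℕ.+-∸-comm r y≤h))))
        (Near-+ (Near-- (small a (h ∸ y) (ℕ.≤-trans (ℕ.m∸n≤m h y) bounded)) (small a h bounded)) (p a))

  -- Among `m ^ s + 1` members of a chain, two have nearly equal values modulo 1 under every `Q a`,
  -- by the pigeonhole principle; almost additivity turns this into smallness at their difference.
  recurrence-suc : Recurrence (suc D)
  recurrence-suc s ε 0<ε = X , find
    where
    bx = boxes (½-pos 0<ε)
    m = suc (proj₁ bx)
    δ = proj₁ (proj₂ bx)
    0≤δ = proj₁ (proj₂ (proj₂ bx))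
    δ≤½ε = proj₁ (proj₂ (proj₂ (proj₂ bx)))
    δm≡1 = proj₂ (proj₂ (proj₂ (proj₂ bx)))
    chn = chain s (½ * ε) (½-pos 0<ε) (m ^ s)
    X = proj₁ chn
    find : ∀ (Q : Fin s → ℕ → ℚ) → (∀ a → Vanishing (suc D) (Q a)) →
           ∃[ r ] 1 ℕ.≤ r × r ℕ.≤ X × ∀ a → Near ε (Q a r)
    find Q vQ = x ∸ y , ℕ.m<n⇒0<n∸m (AllPairs-lookup decr i<j) ,
        ℕ.≤-trans (ℕ.m∸n≤m x y) (ℕ.≤-trans x≤top bounded) ,
        λ a → subst₂ Near (½-split ε)
          (solve 3 (λ q x y → (q :- (x :- y)) :+ (x :- y) := q) refl (Q a (x ∸ y)) (Q a x) (Q a y))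
          (Near-+ (AllPairs-lookup additive i<j a) (Near-mono δ≤½ε (quantise-≡ (Q a x) (Q a y) m 0≤δ δm≡1 (same a))))
      where
      open Chain (proj₂ chn Q vQ)
      xs = top ∷ rest
      colour : Fin (length xs) → Fin s → Fin m
      colour i a = quantise m (Q a (List.lookup xs i))
      ph = Fin.pigeonhole (ℕ.s≤s (ℕ.≤-reflexive (sym size))) (λ i → funToFin (colour i))
      i = proj₁ ph
      j = proj₁ (proj₂ ph)
      i<j = proj₁ (proj₂ (proj₂ ph))
      x = List.lookup xs i
      y = List.lookup xs j
      same : ∀ a → colour i a ≡ colour j a
      same a = trans (sym (Fin.finToFun-funToFin (colour i) a))
        (trans (cong (λ k → finToFun k a) (proj₂ (proj₂ (proj₂ ph)))) (Fin.finToFun-funToFin (colour j) a))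
      x≤top : x ℕ.≤ top
      x≤top = All.lookup (ℕ.≤-refl ∷ All.map ℕ.<⇒≤ (AllPairs.head decr)) (∈-lookup i)

recurrence : ∀ D → Recurrence D
-- A constant that vanishes at 0 is zero, so `r = 1` will do.
recurrence zero s ε 0<ε = 1 , λ Q vQ → 1 , ℕ.≤-refl , ℕ.≤-refl , λ a →
  Near-∣∣ (subst (λ q → ∣ q ∣ ℚ.≤ ε)
    (trans (sym (proj₁ (vQ a) tt 0))
      (trans (cong (λ z → Q a 1 - z) (proj₂ (vQ a))) (ℚ.+-identityʳ (Q a 1))))
    (ℚ.<⇒≤ 0<ε))
recurrence (suc D) = recurrence-suc (recurrence D)

-- Words of switching events acting on functionals

-- binom j r is the binomial coefficient of r − 1 over j.
binom : ℕ → ℕ → ℚ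
binom zero    r       = 1ℚ
binom (suc j) zero    = - binom j 0
binom (suc j) (suc r) = binom (suc j) r + binom j r

-- Leibniz rule: the difference of `binom (suc j)` is `binom j`, and each of the two terms has one
-- factor of lower degree.
Deg<-binom : ∀ j m {g} → Deg< m g → Deg< (j ℕ.+ m) (λ r → binom j r * g r)
Deg<-binom zero    m {g} dg = Deg<-cong m (λ r → sym (ℚ.*-identityˡ (g r))) dg
Deg<-binom (suc j) zero {g} dg = Deg<-0 (suc j ℕ.+ 0) (λ r → trans (cong (binom (suc j) r *_) (dg r)) (ℚ.*-zeroʳ (binom (suc j) r)))
Deg<-binom (suc j) (suc m) {g} dg tt = Deg<-cong (j ℕ.+ suc m)
  (λ r → solve 4 (λ B b g′ g → b :* g′ :+ B :* (g′ :- g) := (B :+ b) :* g′ :- B :* g)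
    refl (binom (suc j) r) (binom j r) (g (suc r)) (g r))
  (Deg<-+ (j ℕ.+ suc m)
    (Deg<-binom j (suc m) (Deg<-shift-+ (suc m) {g} 1 dg))
    (subst (λ n → Deg< n (λ r → binom (suc j) r * (g (suc r) - g r))) (sym (ℕ.+-suc j m))
      (Deg<-binom (suc j) m (dg tt))))

module Words (k : ℕ) where

  Track : Set
  Track = Fin (suc k)

  -- With S = S c t, first c stands for the difference P (x + S) − P x, and second c for
  -- P (x + S) − 2 P x + P (x − S).
  data Letter : Set where
    first second : Track → Letter

  data Event : Set where
    on off : Track → Event

  weight : List Letter → ℕ
  weight []             = 0
  weight (first  _ ∷ w) = 1 ℕ.+ weight w
  weight (second _ ∷ w) = 2 ℕ.+ weight w

  Functional : Set
  Functional = List Letter → ℚ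

  Endo : Set
  Endo = Functional → Functional

  infix 4 _≐_
  _≐_ : Functional → Functional → Set
  u ≐ v = ∀ w → u w ≡ v w

  -- If `u` records the differences of `P` at `x`, these record the ones at `x + S` and `x - S`, the
  -- latter by `P (x - S) = P x - (P (x + S) - P x) + (P (x + S) - 2 P x + P (x - S))`. The centred
  -- second difference shows that off and on cancel to first order.
  switchOn switchOff : Track → Endo
  switchOn  c u w = u w + u (first c ∷ w)
  switchOff c u w = (u w - u (first c ∷ w)) + u (second c ∷ w)

  act : Event → Endo
  act (on c)  = switchOn c
  act (off c) = switchOff c

  run : List Event → Endo
  run []      u = u
  run (a ∷ W) u = run W (act a u)

  run-++ : ∀ W W′ u → run (W ++ W′) u ≡ run W′ (run W u)
  run-++ []      W′ u = refl
  run-++ (a ∷ W) W′ u = run-++ W W′ (act a u)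

  record Linear (t : Endo) : Set where
    field
      ≐-cong  : ∀ {u v} → u ≐ v → t u ≐ t v
      homo-+  : ∀ u v → t (λ w → u w + v w) ≐ (λ w → t u w + t v w)
      homo-*  : ∀ c u → t (λ w → c * u w) ≐ (λ w → c * t u w)

    homo-- : ∀ u v → t (λ w → u w - v w) ≐ (λ w → t u w - t v w)
    homo-- u v w = begin
      t (λ w → u w - v w) w              ≡⟨ ≐-cong (λ w → solve 2 (λ a b → a :- b := a :+ con (- 1ℚ) :* b) refl (u w) (v w)) w ⟩
      t (λ w → u w + - 1ℚ * v w) w       ≡⟨ homo-+ u (λ w → - 1ℚ * v w) w ⟩
      t u w + t (λ w → - 1ℚ * v w) w     ≡⟨ cong (λ z → t u w + z) (homo-* (- 1ℚ) v w) ⟩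
      t u w + - 1ℚ * t v w               ≡⟨ solve 2 (λ a b → a :+ con (- 1ℚ) :* b := a :- b) refl (t u w) (t v w) ⟩
      t u w - t v w                      ∎
      where open ≡-Reasoning

  open Linear

  Linear-id : Linear (λ u → u)
  Linear-id = record { ≐-cong = λ p → p ; homo-+ = λ _ _ _ → refl ; homo-* = λ _ _ _ → refl }

  Linear-∘ : ∀ {s t} → Linear s → Linear t → Linear (s ∘ t)
  Linear-∘ ls lt = record
    { ≐-cong = λ p → ≐-cong ls (≐-cong lt p)
    ; homo-+ = λ u v w → trans (≐-cong ls (homo-+ lt u v) w) (homo-+ ls _ _ w)
    ; homo-* = λ c u w → trans (≐-cong ls (homo-* lt c u) w) (homo-* ls c _ w) }

  Linear-act : ∀ a → Linear (act a)
  Linear-act (on c) = record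
    { ≐-cong = λ p w → cong₂ _+_ (p w) (p (first c ∷ w))
    ; homo-+ = λ u v w → solve 4 (λ a b c d → (a :+ b) :+ (c :+ d) := (a :+ c) :+ (b :+ d)) refl (u w) (v w) (u (first c ∷ w)) (v (first c ∷ w))
    ; homo-* = λ e u w → sym (ℚ.*-distribˡ-+ e (u w) (u (first c ∷ w))) }
  Linear-act (off c) = record
    { ≐-cong = λ p w → cong₂ _+_ (cong₂ _-_ (p w) (p (first c ∷ w))) (p (second c ∷ w))
    ; homo-+ = λ u v w → solve 6 (λ a b c d e f → ((a :+ b) :- (c :+ d)) :+ (e :+ f) := ((a :- c) :+ e) :+ ((b :- d) :+ f)) refl (u w) (v w) (u (first c ∷ w)) (v (first c ∷ w)) (u (second c ∷ w)) (v (second c ∷ w))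
    ; homo-* = λ e u w → solve 4 (λ e a b c → (e :* a :- e :* b) :+ e :* c := e :* ((a :- b) :+ c)) refl e (u w) (u (first c ∷ w)) (u (second c ∷ w)) }

  Linear-run : ∀ W → Linear (run W)
  Linear-run []      = Linear-id
  Linear-run (a ∷ W) = Linear-∘ (Linear-run W) (Linear-act a)

  -- Unipotent operators and their binomial series

  infix 10 _−id
  _−id : Endo → Endo
  (t −id) u w = t u w - u w

  Linear-−id : ∀ {t} → Linear t → Linear (t −id)
  Linear-−id {t} lt = record
    { ≐-cong = λ p w → cong₂ _-_ (≐-cong lt p w) (p w)
    ; homo-+ = λ u v w → trans (cong (_- (u w + v w)) (homo-+ lt u v w))
        (solve 4 (λ a b c d → (a :+ b) :- (c :+ d) := (a :- c) :+ (b :- d)) refl (t u w) (t v w) (u w) (v w))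
    ; homo-* = λ c u w → trans (cong (_- c * u w) (homo-* lt c u w))
        (solve 3 (λ c a b → c :* a :- c :* b := c :* (a :- b)) refl c (t u w) (u w)) }

  -- The tail Σ_{i ≤ j ≤ i+J} binom j e · (t − 1)ʲ⁻ⁱ of the binomial series of tᵉ⁻¹.
  series : Endo → ℕ → ℕ → ℕ → Endo
  series t e zero    i u w = binom i e * u w
  series t e (suc J) i u w = binom i e * u w + series t e J (suc i) ((t −id) u) w

  Linear-series : ∀ {t} → Linear t → ∀ e J i → Linear (series t e J i)
  Linear-series lt e zero i = record
    { ≐-cong = λ p w → cong (binom i e *_) (p w)
    ; homo-+ = λ u v w → ℚ.*-distribˡ-+ (binom i e) (u w) (v w)
    ; homo-* = λ c u w → solve 3 (λ b c a → b :* (c :* a) := c :* (b :* a)) refl (binom i e) c (u w) }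
  Linear-series {t} lt e (suc J) i = record
    { ≐-cong = λ p w → cong₂ _+_ (cong (binom i e *_) (p w)) (≐-cong lσ p w)
    ; homo-+ = λ u v w → trans (cong (λ z → binom i e * (u w + v w) + z) (homo-+ lσ u v w))
        (solve 5 (λ b u v s s′ → b :* (u :+ v) :+ (s :+ s′) := (b :* u :+ s) :+ (b :* v :+ s′)) refl
          (binom i e) (u w) (v w) (series t e J (suc i) ((t −id) u) w) (series t e J (suc i) ((t −id) v) w))
    ; homo-* = λ c u w → trans (cong (λ z → binom i e * (c * u w) + z) (homo-* lσ c u w))
        (solve 4 (λ b c a s → b :* (c :* a) :+ c :* s := c :* (b :* a :+ s)) refl
          (binom i e) c (u w) (series t e J (suc i) ((t −id) u) w)) }
    where lσ = Linear-∘ (Linear-series lt e J (suc i)) (Linear-−id lt)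

  module _ {t : Endo} (lt : Linear t) where

    series-comm : ∀ e J i u → (t −id) (series t e J i u) ≐ series t e J i ((t −id) u)
    series-comm e zero    i u w = homo-* (Linear-−id lt) (binom i e) u w
    series-comm e (suc J) i u w = trans (homo-+ (Linear-−id lt) _ _ w)
      (cong₂ _+_ (homo-* (Linear-−id lt) (binom i e) u w) (series-comm e J (suc i) ((t −id) u) w))

    series-pascal : ∀ e J i u →
      series t (suc e) J (suc i) u ≐ (λ w → series t e J (suc i) u w + series t e J i u w)
    series-pascal e zero    i u w = ℚ.*-distribʳ-+ (u w) (binom (suc i) e) (binom i e)
    series-pascal e (suc J) i u w = trans
      (cong (λ z → (binom (suc i) e + binom i e) * u w + z) (series-pascal e J (suc i) ((t −id) u) w))
      (solve 5 (λ B b u s s′ → (B :+ b) :* u :+ (s :+ s′) := (B :* u :+ s) :+ (b :* u :+ s′)) refl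
        (binom (suc i) e) (binom i e) (u w) (series t e J (2 ℕ.+ i) ((t −id) u) w) (series t e J (suc i) ((t −id) u) w))

    iterate : ℕ → Endo
    iterate zero    u = u
    iterate (suc j) u = iterate j ((t −id) u)

    series-truncate : ∀ e J i u → (∀ w → iterate (suc J) u w ≡ 0ℚ) →
      series t e (suc J) i u ≐ series t e J i u
    series-truncate e zero i u vanish w = trans
      (cong (λ z → binom i e * u w + binom (suc i) e * z) (vanish w))
      (solve 2 (λ a b → a :+ b :* con 0ℚ := a) refl (binom i e * u w) (binom (suc i) e))
    series-truncate e (suc J) i u vanish w =
      cong (λ z → binom i e * u w + z) (series-truncate e J (suc i) ((t −id) u) vanish w)

    -- This is `t · tᵉ⁻¹ = tᵉ`. With `t = 1 + (t − 1)`, the highest term of the second summand dies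
    -- by nilpotency and Pascal's rule merges the two series.
    series-suc : ∀ e J u → (∀ w → iterate (2 ℕ.+ J) u w ≡ 0ℚ) →
      t (series t e (suc J) 0 u) ≐ series t (suc e) (suc J) 0 u
    series-suc e J u vanish w = begin
      t S w                                                ≡⟨ solve 2 (λ a b → a := b :+ (a :- b)) refl (t S w) (S w) ⟩
      S w + (t −id) S w                                     ≡⟨ cong (λ z → S w + z) (series-comm e (suc J) 0 u w) ⟩
      S w + series t e (suc J) 0 ((t −id) u) w              ≡⟨ cong (λ z → S w + z) (series-truncate e J 0 ((t −id) u) vanish w) ⟩
      S w + series t e J 0 ((t −id) u) w                    ≡⟨ ℚ.+-assoc (1ℚ * u w) _ _ ⟩
      1ℚ * u w + (series t e J 1 ((t −id) u) w + series t e J 0 ((t −id) u) w)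
                                                           ≡⟨ cong (λ z → 1ℚ * u w + z) (series-pascal e J 0 ((t −id) u) w) ⟨
      series t (suc e) (suc J) 0 u w                       ∎
      where
      open ≡-Reasoning
      S = series t e (suc J) 0 u

    binom-1 : ∀ i → binom (suc i) 1 ≡ 0ℚ
    binom-1 i = ℚ.+-inverseˡ (binom i 0)

    series-1-suc : ∀ J i u w → series t 1 J (suc i) u w ≡ 0ℚ
    series-1-suc zero    i u w = trans (cong (_* u w) (binom-1 i)) (ℚ.*-zeroˡ (u w))
    series-1-suc (suc J) i u w = cong₂ _+_
      (trans (cong (_* u w) (binom-1 i)) (ℚ.*-zeroˡ (u w))) (series-1-suc J (suc i) ((t −id) u) w)

    -- At exponent 0 all binomials of positive index vanish.
    series-1 : ∀ J u → series t 1 (suc J) 0 u ≐ u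
    series-1 J u w = trans (cong (λ z → 1ℚ * u w + z) (series-1-suc J 0 ((t −id) u) w))
      (solve 1 (λ a → con 1ℚ :* a :+ con 0ℚ := a) refl (u w))

  -- A letter of weight 1 counts as suc k, the degree in the parameter r as 1.
  Fil : ℕ → (ℕ → Functional) → Set
  Fil n f = ∀ w → Deg< (n ∸ suc k ℕ.* weight w) (λ r → f r w)

  Fil-mono : ∀ {m n f} → m ℕ.≤ n → Fil m f → Fil n f
  Fil-mono {f = f} m≤n F w = Deg<-mono {f = λ r → f r w} (ℕ.∸-monoˡ-≤ (suc k ℕ.* weight w) m≤n) (F w)

  Fil-cong : ∀ {n f g} → (∀ r → f r ≐ g r) → Fil n f → Fil n g
  Fil-cong {n} f≐g F w = Deg<-cong (n ∸ suc k ℕ.* weight w) (λ r → f≐g r w) (F w)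

  Fil-+ : ∀ {n f g} → Fil n f → Fil n g → Fil n (λ r w → f r w + g r w)
  Fil-+ {n} F G w = Deg<-+ (n ∸ suc k ℕ.* weight w) (F w) (G w)

  Fil-0 : ∀ n {f} → (∀ r w → f r w ≡ 0ℚ) → Fil n f
  Fil-0 n f≐0 w = Deg<-0 (n ∸ suc k ℕ.* weight w) (λ r → f≐0 r w)

  Fil-0⁻¹ : ∀ {f} → Fil 0 f → ∀ r w → f r w ≡ 0ℚ
  Fil-0⁻¹ {f} F r w = subst (λ m → Deg< m (λ r → f r w)) (ℕ.0∸n≡0 (suc k ℕ.* weight w)) (F w) r

  -- A factor of degree `i` in `r` costs `i`. Where the subtraction is truncated, `f` is zero and so
  -- is the product.
  Fil-binom : ∀ i n {f} → Fil n f → Fil (i ℕ.+ n) (λ r w → binom i r * f r w)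
  Fil-binom i n {f} F w with suc k ℕ.* weight w ℕ.≤? n
  ... | yes le = subst (λ m → Deg< m (λ r → binom i r * f r w)) (sym (ℕ.+-∸-assoc i le))
    (Deg<-binom i (n ∸ suc k ℕ.* weight w) (F w))
  ... | no ≰ = Deg<-0 (i ℕ.+ n ∸ suc k ℕ.* weight w) λ r →
    trans (cong (binom i r *_) (subst (λ m → Deg< m (λ r → f r w)) (ℕ.m≤n⇒m∸n≡0 (ℕ.<⇒≤ (ℕ.≰⇒> ≰))) (F w) r))
          (ℚ.*-zeroʳ (binom i r))

  -- Operators depending on the parameter r

  Family : Set
  Family = ℕ → Endo

  -- The argument `f` may depend on `r` as well, because powers whose exponent depends on `r` will
  -- be nested.
  record Lowers (m : ℕ) (T : Family) : Set where
    field
      linear : ∀ r → Linear (T r)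
      lower  : ∀ {n f} → Fil n f → Fil (n ∸ m) (λ r → (T r −id) (f r))

    preserves : ∀ {n f} → Fil n f → Fil n (λ r → T r (f r))
    preserves {n} {f} F = Fil-cong (λ r w → solve 2 (λ a b → (a :- b) :+ b := a) refl (T r (f r) w) (f r w))
      (Fil-+ (Fil-mono {f = λ r → (T r −id) (f r)} (ℕ.m∸n≤m n m) (lower F)) F)

  open Lowers

  Lowers-mono : ∀ {m n T} → m ℕ.≤ n → Lowers n T → Lowers m T
  Lowers-mono {m} {n} {T} m≤n L = record
    { linear = linear L
    ; lower  = λ {n = p} {f} F → Fil-mono {f = λ r → (T r −id) (f r)} (ℕ.∸-monoʳ-≤ p m≤n) (lower L F) }

  Lowers-id : ∀ m → Lowers m (λ _ u → u)
  Lowers-id m = record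
    { linear = λ _ → Linear-id
    ; lower  = λ {n} {f} _ → Fil-0 (n ∸ m) (λ r w → ℚ.+-inverseʳ (f r w)) }

  Lowers-∘ : ∀ {m S T} → Lowers m S → Lowers m T → Lowers m (λ r → S r ∘ T r)
  Lowers-∘ {S = S} {T} LS LT = record
    { linear = λ r → Linear-∘ (linear LS r) (linear LT r)
    ; lower  = λ {n} {f} F → Fil-cong
        (λ r w → solve 3 (λ a b c → (a :- b) :+ (b :- c) := a :- c) refl (S r (T r (f r)) w) (T r (f r) w) (f r w))
        (Fil-+ {f = λ r → (S r −id) (T r (f r))} (lower LS (preserves LT F)) (lower LT F)) }

  -- `act a −id` reads `u` only at words with a letter prepended, and each unit of weight counts
  -- `suc k`.
  Lowers-act : ∀ a → Lowers (suc k) (λ _ → act a)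
  Lowers-act a = record { linear = λ _ → Linear-act a ; lower = low a }
    where
    s = suc k
    bound : ∀ n v w → suc (weight w) ℕ.≤ weight v → n ∸ s ℕ.* weight v ℕ.≤ n ∸ s ∸ s ℕ.* weight w
    bound n v w le = begin
      n ∸ s ℕ.* weight v             ≤⟨ ℕ.∸-monoʳ-≤ n (ℕ.*-monoʳ-≤ s le) ⟩
      n ∸ s ℕ.* suc (weight w)       ≡⟨ cong (n ∸_) (ℕ.*-suc s (weight w)) ⟩
      n ∸ (s ℕ.+ s ℕ.* weight w)     ≡⟨ ℕ.∸-+-assoc n s (s ℕ.* weight w) ⟨
      n ∸ s ∸ s ℕ.* weight w         ∎
      where open ℕ.≤-Reasoning
    low : ∀ a {n f} → Fil n f → Fil (n ∸ s) (λ r → (act a −id) (f r))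
    low (on c) {n} {f} F w = Deg<-cong (n ∸ s ∸ s ℕ.* weight w)
      (λ r → solve 2 (λ a b → b := (a :+ b) :- a) refl (f r w) (f r (first c ∷ w)))
      (Deg<-mono {f = λ r → f r (first c ∷ w)} (bound n (first c ∷ w) w ℕ.≤-refl) (F (first c ∷ w)))
    low (off c) {n} {f} F w = Deg<-cong (n ∸ s ∸ s ℕ.* weight w)
      (λ r → solve 3 (λ a b c → c :- b := ((a :- b) :+ c) :- a) refl (f r w) (f r (first c ∷ w)) (f r (second c ∷ w)))
      (Deg<-- (n ∸ s ∸ s ℕ.* weight w) {λ r → f r (second c ∷ w)} {λ r → f r (first c ∷ w)}
        (Deg<-mono {f = λ r → f r (second c ∷ w)} (bound n (second c ∷ w) w (ℕ.n≤1+n _)) (F (second c ∷ w)))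
        (Deg<-mono {f = λ r → f r (first c ∷ w)} (bound n (first c ∷ w) w ℕ.≤-refl) (F (first c ∷ w))))

  topDegree : ℕ
  topDegree = suc k ℕ.+ k ℕ.* suc (suc k)

  -- Definitionally equal to suc topDegree.
  degree : ℕ
  degree = suc k ℕ.* suc (suc k)

  -- T raised to the power r − 1: the inverse of T at r = 0.
  power : Family → Family
  power T r = series (T r) r degree 0

  -- In use, `u` collects differences of a polynomial of degree at most `suc k`, and those of higher
  -- order are zero.
  Supported : Functional → Set
  Supported u = ∀ w → suc k ℕ.< weight w → u w ≡ 0ℚ

  -- Up to weight `suc k` the bound `degree ∸ suc k * weight w` is positive and admits constants in
  -- `r`; for larger weights the value is zero.
  Supported⇒Fil : ∀ {u} → Supported u → Fil degree (λ _ → u)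
  Supported⇒Fil {u} supp w with weight w ℕ.≤? suc k
  ... | yes le = subst (λ m → Deg< m (λ _ → u w)) eq (Deg<-const _ (u w))
    where
    eq : suc (suc k ∸ weight w ℕ.+ k ℕ.* (suc (suc k) ∸ weight w)) ≡ degree ∸ suc k ℕ.* weight w
    eq = trans (cong (λ z → z ℕ.+ k ℕ.* (suc (suc k) ∸ weight w)) (sym (ℕ.+-∸-assoc 1 le)))
               (ℕ.*-distribˡ-∸ (suc k) (suc (suc k)) (weight w))
  ... | no ≰ = Deg<-0 (degree ∸ suc k ℕ.* weight w) (λ _ → supp w (ℕ.≰⇒> ≰))

  Fil⇒Supported : ∀ {f} → Fil degree f → ∀ r → Supported (f r)
  Fil⇒Supported {f} F r w lt = subst (λ m → Deg< m (λ r → f r w))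
    (ℕ.m≤n⇒m∸n≡0 (ℕ.*-monoʳ-≤ (suc k) lt)) (F w) r

  Supported-preserved : ∀ {m T} → Lowers m T → ∀ r {u} → Supported u → Supported (T r u)
  Supported-preserved L r supp = Fil⇒Supported (preserves L (Supported⇒Fil supp)) r

  module _ {m T} (L : Lowers (suc m) T) where

    -- Each factor `T r − 1` lowers the filtration by at least one, so `suc degree` factors exhaust
    -- it.
    iterate-vanishes : ∀ r {u} → Supported u → ∀ w → iterate (linear L r) (suc degree) u w ≡ 0ℚ
    iterate-vanishes r {u} supp w = go (suc degree) degree (λ _ → u) (ℕ.n≤1+n degree) (Supported⇒Fil supp)
      where
      go : ∀ j n f → n ℕ.≤ j → Fil n f → iterate (linear L r) j (f r) w ≡ 0ℚ
      go zero    zero    f _   F = Fil-0⁻¹ F r w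
      go (suc j) n       f le  F = go j (n ∸ suc m) (λ r → (T r −id) (f r))
        (ℕ.≤-trans (ℕ.∸-monoʳ-≤ n (ℕ.s≤s ℕ.z≤n)) (ℕ.∸-monoˡ-≤ 1 le)) (lower L F)

    power-suc : ∀ r e {u} → Supported u →
      T r (series (T r) e degree 0 u) ≐ series (T r) (suc e) degree 0 u
    power-suc r e {u} supp = series-suc (linear L r) e topDegree u (iterate-vanishes r supp)

    -- Passing to the next term raises the degree of the binomial by one and lowers the filtration
    -- by at least one, so a bound `p` for the leading term serves for all. At `n = 0` the
    -- functional is zero, hence the condition `1 ≤ n`.
    series-Fil : ∀ J i n p {f} → Fil n f → (1 ℕ.≤ n → i ℕ.+ n ℕ.≤ p) →
      Fil p (λ r → series (T r) r J i (f r))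
    series-Fil J i zero p {f} F _ = Fil-0 p (λ r w → trans
      (≐-cong (Linear-series (linear L r) r J i) (λ w → trans (Fil-0⁻¹ F r w) (sym (ℚ.*-zeroˡ (f r w)))) w)
      (trans (homo-* (Linear-series (linear L r) r J i) 0ℚ (f r) w) (ℚ.*-zeroˡ (series (T r) r J i (f r) w))))
    series-Fil zero i (suc n) p {f} F le =
      Fil-mono {f = λ r w → binom i r * f r w} (le (ℕ.s≤s ℕ.z≤n)) (Fil-binom i (suc n) F)
    series-Fil (suc J) i (suc n) p {f} F le = Fil-+
      (Fil-mono {f = λ r w → binom i r * f r w} (le (ℕ.s≤s ℕ.z≤n)) (Fil-binom i (suc n) F))
      (series-Fil J (suc i) (n ∸ m) p {λ r → (T r −id) (f r)} (lower L F)
        (λ _ → ℕ.≤-trans (ℕ.≤-reflexive (sym (ℕ.+-suc i (n ∸ m))))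
          (ℕ.≤-trans (ℕ.+-monoʳ-≤ i (ℕ.s≤s (ℕ.m∸n≤m n m))) (le (ℕ.s≤s ℕ.z≤n)))))

    -- For `j ≥ 1` the `j`-th term of the series gains `j (m + 1)` from `T − 1` and loses `j` to the
    -- binomial, which leaves at least `m`.
    Lowers-power : Lowers m (power T)
    Lowers-power = record
      { linear = λ r → Linear-series (linear L r) r degree 0
      ; lower  = λ {n} {f} F → Fil-cong
          (λ r w → solve 2 (λ a s → s := (con 1ℚ :* a :+ s) :- a) refl (f r w) (series (T r) r topDegree 1 ((T r −id) (f r)) w))
          (series-Fil topDegree 1 (n ∸ suc m) (n ∸ m) {λ r → (T r −id) (f r)} (lower L F) (arith n))
      }
      where
      arith : ∀ n → 1 ℕ.≤ n ∸ suc m → 1 ℕ.+ (n ∸ suc m) ℕ.≤ n ∸ m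
      arith n pos = subst (λ z → suc z ℕ.≤ n ∸ m) (ℕ.pred[m∸n]≡m∸[1+n] n m)
        (ℕ.≤-reflexive (ℕ.suc-pred (n ∸ m) {{ℕ.>-nonZero (ℕ.≤-trans pos (ℕ.∸-monoʳ-≤ n (ℕ.n≤1+n m)))}}))

-- Covering words that are trivial at r = 0

module Detours (k : ℕ) where
  open Words k
  open Linear
  open Lowers

  base : Track
  base = zero

  -- With v = loop cs, loop (c ∷ cs) is v · on c · v⁻¹ · (on c)⁻¹, read from left to right, in which
  -- v⁻¹ = vʳ⁻¹ and (on c)⁻¹ = off c · (on c · off c)ʳ⁻¹ at r = 0.
  detour loop : List Track → Family
  detour []       r u = u
  detour (c ∷ cs) r u = power (λ _ → switchOff c ∘ switchOn c) r (switchOff c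
    (power (λ r u → detour cs r (switchOn base (switchOff base u))) r (switchOn c (detour cs r u))))

  loop cs r u = detour cs r (switchOn base (switchOff base u))

  -- Every track adds a level of `power`, which costs one unit, while single events supply `suc k`;
  -- this is the budget in the hypothesis.
  Lowers-detour : ∀ cs m → length cs ℕ.+ m ℕ.≤ suc k → Lowers m (detour cs)
  Lowers-loop   : ∀ cs m → length cs ℕ.+ m ℕ.≤ suc k → Lowers m (loop cs)

  Lowers-act≤ : ∀ {m} → m ℕ.≤ suc k → ∀ a → Lowers m (λ _ → act a)
  Lowers-act≤ le a = Lowers-mono le (Lowers-act a)

  Lowers-onOff : ∀ {m} → m ℕ.≤ suc k → ∀ c → Lowers m (λ _ → switchOff c ∘ switchOn c)
  Lowers-onOff le c = Lowers-∘ (Lowers-act≤ le (off c)) (Lowers-act≤ le (on c))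

  Lowers-detour []       m le = Lowers-id m
  Lowers-detour (c ∷ cs) m le =
    Lowers-∘ (Lowers-power (Lowers-onOff sm≤ c)) (Lowers-∘ (Lowers-act≤ m≤ (off c))
      (Lowers-∘ (Lowers-power (Lowers-loop cs (suc m) le′))
        (Lowers-∘ (Lowers-act≤ m≤ (on c)) (Lowers-mono (ℕ.n≤1+n m) (Lowers-detour cs (suc m) le′)))))
    where
    le′ : length cs ℕ.+ suc m ℕ.≤ suc k
    le′ = subst (ℕ._≤ suc k) (sym (ℕ.+-suc (length cs) m)) le
    sm≤ = ℕ.m+n≤o⇒n≤o (length cs) le′
    m≤ = ℕ.≤-trans (ℕ.n≤1+n m) sm≤

  Lowers-loop cs m le = Lowers-∘ (Lowers-detour cs m le)
    (Lowers-∘ (Lowers-act≤ m≤ (on base)) (Lowers-act≤ m≤ (off base)))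
    where m≤ = ℕ.m+n≤o⇒n≤o (length cs) le

  -- `power-suc` raises the exponent from -1 to 0, so `power T 0` is a right inverse of `T 0`.
  power-0 : ∀ {m T} (L : Lowers (suc m) T) {u} → Supported u → T 0 (power T 0 u) ≐ u
  power-0 L {u} supp w = trans (power-suc L 0 0 supp w) (series-1 (linear L 0) topDegree u w)

  -- Lowering of weight at r = 0

  VanishesFrom : ℕ → Functional → Set
  VanishesFrom m u = ∀ w → m ℕ.≤ weight w → u w ≡ 0ℚ

  -- For a fixed operator there is no degree in `r` to account for, so weight alone is counted.
  LowersWeight : ℕ → Endo → Set
  LowersWeight j t = ∀ {m u} → m ℕ.≤ 2 ℕ.+ k → VanishesFrom m u → VanishesFrom (m ∸ j) ((t −id) u)

  unshift : ∀ {m n j} → m ∸ j ℕ.≤ n → m ℕ.≤ j ℕ.+ n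
  unshift {m} {n} {j} le = ℕ.≤-trans (ℕ.m≤n+m∸n m j) (ℕ.+-monoʳ-≤ j le)

  VanishesFrom-mono : ∀ {m n u} → m ℕ.≤ n → VanishesFrom m u → VanishesFrom n u
  VanishesFrom-mono m≤n V w n≤w = V w (ℕ.≤-trans m≤n n≤w)

  VanishesFrom-- : ∀ {m u v} → VanishesFrom m u → VanishesFrom m v → VanishesFrom m (λ w → u w - v w)
  VanishesFrom-- U V w le = cong₂ _-_ (U w le) (V w le)

  LowersWeight-act : ∀ a → LowersWeight 1 (act a)
  LowersWeight-act (on c) {m} {u} _ V w le = trans
    (solve 2 (λ a b → (a :+ b) :- a := b) refl (u w) (u (first c ∷ w)))
    (V (first c ∷ w) (unshift {m} le))
  LowersWeight-act (off c) {m} {u} _ V w le = trans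
    (solve 3 (λ a b c → ((a :- b) :+ c) :- a := c :- b) refl (u w) (u (first c ∷ w)) (u (second c ∷ w)))
    (cong₂ _-_ (V (second c ∷ w) (ℕ.≤-trans (unshift {m} le) (ℕ.n≤1+n _))) (V (first c ∷ w) (unshift {m} le)))

  -- The first differences cancel in the product; the remaining terms prepend letters of total
  -- weight two or three.
  LowersWeight-offOn : ∀ c → LowersWeight 2 (switchOn c ∘ switchOff c)
  LowersWeight-offOn c {m} {u} _ V w le = trans
    (solve 5 (λ a b c d e → (((a :- b) :+ c) :+ ((b :- d) :+ e)) :- a := (c :- d) :+ e) refl
      (u w) (u (first c ∷ w)) (u (second c ∷ w)) (u (first c ∷ first c ∷ w)) (u (second c ∷ first c ∷ w)))
    (cong₂ _+_ (cong₂ _-_ (V (second c ∷ w) le′) (V (first c ∷ first c ∷ w) le′))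
      (V (second c ∷ first c ∷ w) (ℕ.≤-trans le′ (ℕ.n≤1+n _))))
    where le′ = unshift {m} {weight w} {2} le

  -- A unipotent operator is injective, compatibly with weights: in `e = t e − (t − 1) e` the last
  -- term vanishes from one weight lower than `e` is known to, so the range where `e` vanishes grows
  -- step by step down to `m`.
  VanishesFrom-reflect : ∀ t → LowersWeight 1 t → ∀ m {e} → m ℕ.≤ 2 ℕ.+ k →
    VanishesFrom (2 ℕ.+ k) e → VanishesFrom m (t e) → VanishesFrom m e
  VanishesFrom-reflect t low m {e} m≤ E TE =
    go (2 ℕ.+ k ∸ m) (ℕ.≤-reflexive eq) (subst (λ n → VanishesFrom n e) (sym eq) E)
    where
    eq : m ℕ.+ (2 ℕ.+ k ∸ m) ≡ 2 ℕ.+ k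
    eq = ℕ.m+[n∸m]≡n m≤
    go : ∀ j → m ℕ.+ j ℕ.≤ 2 ℕ.+ k → VanishesFrom (m ℕ.+ j) e → VanishesFrom m e
    go zero    le V = subst (λ n → VanishesFrom n e) (ℕ.+-identityʳ m) V
    go (suc j) le V = go j (ℕ.≤-trans (ℕ.+-monoʳ-≤ m (ℕ.n≤1+n j)) le) λ w le′ → begin
      e w                      ≡⟨ solve 2 (λ a b → a := b :- (b :- a)) refl (e w) (t e w) ⟩
      t e w - (t −id) e w      ≡⟨ cong₂ _-_ (TE w (ℕ.≤-trans (ℕ.m≤m+n m j) le′))
                                   (low le V w (subst (ℕ._≤ weight w) (cong (_∸ 1) (sym (ℕ.+-suc m j))) le′)) ⟩
      0ℚ                       ∎
      where open ≡-Reasoning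

  -- At r = 0 the loop is an iterated commutator.
  LowersWeight-loop : ∀ cs → length cs ℕ.≤ k → LowersWeight (2 ℕ.+ length cs) (loop cs 0)
  LowersWeight-loop []       _  = LowersWeight-offOn base
  -- The loop sends `u` to `u₅`. It is enough to treat `v (A (u₅ − u))`, since `v` and then `A` can
  -- be removed by reflection.
  LowersWeight-loop (c ∷ cs) le {m} {u} m≤ V = VanishesFrom-reflect A (LowersWeight-act (on c)) n n≤
      (VanishesFrom-- supp₅ supp₀) (VanishesFrom-reflect v lowV n n≤ (Supported-preserved LA 0 (VanishesFrom-- supp₅ supp₀))
        commutator)
    where
    n = m ∸ (3 ℕ.+ length cs)
    n≤ = ℕ.≤-trans (ℕ.m∸n≤m m (3 ℕ.+ length cs)) m≤
    A = switchOn c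
    B = switchOff c
    v = loop cs 0
    LA = Lowers-act (on c)
    LB = Lowers-act (off c)
    LV : Lowers 1 (loop cs)
    LV = Lowers-loop cs 1 (subst (ℕ._≤ suc k) (ℕ.+-comm 1 (length cs)) (ℕ.≤-trans le (ℕ.n≤1+n k)))
    LBA = Lowers-onOff (ℕ.s≤s (ℕ.z≤n {k})) c
    lin-A = Linear-act (on c)
    lin-B = Linear-act (off c)
    lin-v = linear LV 0
    lowV′ : LowersWeight (2 ℕ.+ length cs) v
    lowV′ = LowersWeight-loop cs (ℕ.≤-trans (ℕ.n≤1+n _) le)
    lowV : LowersWeight 1 v
    lowV {m} m≤ V = VanishesFrom-mono (ℕ.∸-monoʳ-≤ m (ℕ.s≤s ℕ.z≤n)) (lowV′ m≤ V)
    u₁ = v u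
    u₂ = A u₁
    u₃ = power (loop cs) 0 u₂
    u₄ = B u₃
    u₅ = power (λ _ → B ∘ A) 0 u₄
    supp₀ : Supported u
    supp₀ = VanishesFrom-mono m≤ V
    supp₂ : Supported u₂
    supp₂ = Supported-preserved LA 0 (Supported-preserved LV 0 supp₀)
    supp₃ : Supported u₃
    supp₃ = Supported-preserved (Lowers-power LV) 0 supp₂
    supp₄ : Supported u₄
    supp₄ = Supported-preserved LB 0 supp₃
    supp₅ : Supported u₅
    supp₅ = Supported-preserved (Lowers-power LBA) 0 supp₄
    -- `B A u₅ = u₄ = B u₃`, and `B` is injective.
    Au₅≐u₃ : A u₅ ≐ u₃
    Au₅≐u₃ w = trans (solve 2 (λ a b → a := (a :- b) :+ b) refl (A u₅ w) (u₃ w))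
      (trans (cong (_+ u₃ w) (VanishesFrom-reflect B (LowersWeight-act (off c)) 0 ℕ.z≤n
        (VanishesFrom-- (Supported-preserved LA 0 supp₅) supp₃)
        (λ w _ → trans (homo-- lin-B (A u₅) u₃ w)
          (trans (cong (_- u₄ w) (power-0 LBA supp₄ w)) (ℚ.+-inverseʳ (u₄ w)))) w ℕ.z≤n))
        (ℚ.+-identityˡ (u₃ w)))
    vAu₅≐Avu : v (A u₅) ≐ A (v u)
    vAu₅≐Avu w = trans (≐-cong lin-v Au₅≐u₃ w) (power-0 LV supp₂ w)
    e : Functional
    e w = u₅ w - u w
    commutator : VanishesFrom n (v (A e))
    commutator w n≤w = begin
      v (A e) w                    ≡⟨ ≐-cong lin-v (homo-- lin-A u₅ u) w ⟩
      v (λ w → A u₅ w - A u w) w   ≡⟨ homo-- lin-v (A u₅) (A u) w ⟩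
      v (A u₅) w - v (A u) w       ≡⟨ cong (_- v (A u) w) (vAu₅≐Avu w) ⟩
      -- `A v − v A` is the commutator of `A − 1` and `v − 1`, so their gains 1 and `2 + length cs`
      -- add up.
      A (v u) w - v (A u) w        ≡⟨ solve 5 (λ Av vA v A u → Av :- vA := ((Av :- A) :- (v :- u)) :- ((vA :- v) :- (A :- u))) refl
                                        (A (v u) w) (v (A u) w) (v u w) (A u w) (u w) ⟩
      ((A (v u) w - A u w) - (v u w - u w)) - ((v (A u) w - v u w) - (A u w - u w))
                                   ≡⟨ cong₂ (λ a b → (a - (v u w - u w)) - (b - (A u w - u w)))
                                        (homo-- lin-A (v u) u w) (homo-- lin-v (A u) u w) ⟨
      (A −id) ((v −id) u) w - (v −id) ((A −id) u) w
                                   ≡⟨ cong₂ _-_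
                                        (LowersWeight-act (on c) (ℕ.≤-trans (ℕ.m∸n≤m m (2 ℕ.+ length cs)) m≤) (lowV′ m≤ V) w
                                          (subst (ℕ._≤ weight w) (trans (cong (m ∸_) (ℕ.+-comm 1 (2 ℕ.+ length cs)))
                                            (sym (ℕ.∸-+-assoc m (2 ℕ.+ length cs) 1))) n≤w))
                                        (lowV′ (ℕ.≤-trans (ℕ.m∸n≤m m 1) m≤) (LowersWeight-act (on c) m≤ V) w
                                          (subst (ℕ._≤ weight w) (sym (ℕ.∸-+-assoc m 1 (2 ℕ.+ length cs))) n≤w)) ⟩
      0ℚ                           ∎
      where open ≡-Reasoning

  -- Words that realise the operators for r ≥ 1

  repeat : ℕ → List Event → List Event
  repeat zero    W = []
  repeat (suc e) W = repeat e W ++ W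

  detourWord loopWord : ℕ → List Track → List Event
  detourWord e []       = []
  detourWord e (c ∷ cs) = detourWord e cs ++ on c ∷ repeat e (off base ∷ on base ∷ detourWord e cs) ++
                          off c ∷ repeat e (on c ∷ off c ∷ [])
  loopWord e cs = off base ∷ on base ∷ detourWord e cs

  -- The exponent is `r − 1`, so at `r = suc e` the series is an honest `e`-fold composition.
  power-repeat : ∀ {m T} (L : Lowers (suc m) T) e W → (∀ {u} → Supported u → T (suc e) u ≐ run W u) →
                 ∀ {u} → Supported u → power T (suc e) u ≐ run (repeat e W) u
  power-repeat {m} {T} L e W T≐W = go e
    where
    go : ∀ j {u} → Supported u → series (T (suc e)) (suc j) degree 0 u ≐ run (repeat j W) u
    go zero    {u} supp = series-1 (linear L (suc e)) topDegree u
    go (suc j) {u} supp w = begin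
      series t (2 ℕ.+ j) degree 0 u w     ≡⟨ power-suc L (suc e) (suc j) supp w ⟨
      t (series t (suc j) degree 0 u) w   ≡⟨ ≐-cong (linear L (suc e)) (go j supp) w ⟩
      t (run (repeat j W) u) w            ≡⟨ T≐W (Supported-run (repeat j W) supp) w ⟩
      run W (run (repeat j W) u) w        ≡⟨ cong (λ f → f w) (run-++ (repeat j W) W u) ⟨
      run (repeat j W ++ W) u w           ∎
      where
      open ≡-Reasoning
      t = T (suc e)
      Supported-run : ∀ W {u} → Supported u → Supported (run W u)
      Supported-run []      supp = supp
      Supported-run (a ∷ W) supp = Supported-run W (Supported-preserved (Lowers-act a) 0 supp)

  detour-run : ∀ cs e → length cs ℕ.≤ k → ∀ {u} → Supported u → detour cs (suc e) u ≐ run (detourWord e cs) u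
  detour-run []       e _  supp w = refl
  detour-run (c ∷ cs) e le {u} supp w = begin
    power BA r (B (power V r (A (D u)))) w
      ≡⟨ power-repeat LBA e (on c ∷ off c ∷ []) (λ _ _ → refl) supp₄ w ⟩
    run Z (B (power V r (A (D u)))) w
      ≡⟨ ≐-cong (Linear-run (off c ∷ Z)) (power-repeat LV e (loopWord e cs) V-run supp₂) w ⟩
    run Z (B (run Y (A (D u)))) w
      ≡⟨ ≐-cong (Linear-∘ (Linear-run (off c ∷ Z)) (Linear-∘ (Linear-run Y) (Linear-act (on c)))) (detour-run cs e le′ supp) w ⟩
    run Z (B (run Y (A (run X u)))) w
      ≡⟨ cong (λ f → f w) (run-++ Y (off c ∷ Z) (A (run X u))) ⟨
    run (on c ∷ Y ++ off c ∷ Z) (run X u) w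
      ≡⟨ cong (λ f → f w) (run-++ X (on c ∷ Y ++ off c ∷ Z) u) ⟨
    run (X ++ on c ∷ Y ++ off c ∷ Z) u w ∎
    where
    open ≡-Reasoning
    le′ = ℕ.≤-trans (ℕ.n≤1+n _) le
    r = suc e
    A = switchOn c
    B = switchOff c
    BA : Family
    BA _ = B ∘ A
    V = loop cs
    D = detour cs r
    X = detourWord e cs
    Y = repeat e (loopWord e cs)
    Z = repeat e (on c ∷ off c ∷ [])
    le″ : length cs ℕ.+ 1 ℕ.≤ suc k
    le″ = subst (ℕ._≤ suc k) (ℕ.+-comm 1 (length cs)) (ℕ.≤-trans le (ℕ.n≤1+n k))
    LV = Lowers-loop cs 1 le″
    LD = Lowers-detour cs 1 le″
    LBA = Lowers-onOff (ℕ.s≤s (ℕ.z≤n {k})) c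
    supp₂ = Supported-preserved (Lowers-act (on c)) 0 (Supported-preserved LD r supp)
    supp₄ = Supported-preserved (Lowers-act (off c)) 0 (Supported-preserved (Lowers-power LV) r supp₂)
    V-run : ∀ {u} → Supported u → V r u ≐ run (loopWord e cs) u
    V-run supp = detour-run cs e le′ (Supported-preserved (Lowers-act (on base)) 0 (Supported-preserved (Lowers-act (off base)) 0 supp))

  -- This is the loop with its opening `off base` rotated to the end. The rotation keeps it trivial
  -- at `r = 0` and lets the detour begin with `base` switched on.
  coverWord : ℕ → List Track → List Event
  coverWord e cs = on base ∷ detourWord e cs ++ off base ∷ []

  cover : List Track → Family
  cover cs r u = switchOff base (detour cs r (switchOn base u))

  cover-run : ∀ cs e → length cs ℕ.≤ k → ∀ {u} → Supported u → cover cs (suc e) u ≐ run (coverWord e cs) u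
  cover-run cs e le {u} supp w = trans
    (≐-cong (Linear-act (off base)) (detour-run cs e le (Supported-preserved (Lowers-act (on base)) 0 supp)) w)
    (cong (λ f → f w) (sym (run-++ (detourWord e cs) (off base ∷ []) (switchOn base u))))

  -- off base is surjective, and cover · off base = off base · loop.
  cover-0 : ∀ cs → length cs ≡ k → ∀ {u} → Supported u → cover cs 0 u ≐ u
  cover-0 cs len {u} supp w = begin
    B (D (A u)) w          ≡⟨ ≐-cong lin u≐Bu′ w ⟨
    B (D (A (B u′))) w     ≡⟨ ≐-cong (Linear-act (off base)) loop-u′ w ⟩
    B u′ w                 ≡⟨ u≐Bu′ w ⟩
    u w                    ∎
    where
    open ≡-Reasoning
    A = switchOn base
    B = switchOff base
    D = detour cs 0
    LB = Lowers-act≤ (ℕ.s≤s (ℕ.z≤n {k})) (off base)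
    le : length cs ℕ.+ 0 ℕ.≤ suc k
    le = subst (ℕ._≤ suc k) (sym (trans (ℕ.+-identityʳ _) len)) (ℕ.n≤1+n k)
    lin = Linear-∘ (Linear-act (off base)) (Linear-∘ (linear (Lowers-detour cs 0 le) 0) (Linear-act (on base)))
    u′ = power (λ _ → B) 0 u
    u≐Bu′ : B u′ ≐ u
    u≐Bu′ = power-0 LB supp
    loop-u′ : loop cs 0 u′ ≐ u′
    loop-u′ w = trans (solve 2 (λ a b → a := (a :- b) :+ b) refl (loop cs 0 u′ w) (u′ w))
      (trans (cong (_+ u′ w) (LowersWeight-loop cs (ℕ.≤-reflexive len) ℕ.≤-refl
          (Supported-preserved (Lowers-power LB) 0 supp) w
          (subst (ℕ._≤ weight w) (sym (trans (cong (k ∸_) len) (ℕ.n∸n≡0 k))) ℕ.z≤n)))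
        (ℚ.+-identityˡ (u′ w)))

  -- `cover` preserves the filtration, whose bound at the empty word is `degree`; at `r = 0` it acts
  -- trivially and returns `u []`.
  cover-Vanishing : ∀ cs → length cs ≡ k → ∀ {u} → Supported u → u [] ≡ 0ℚ →
    Vanishing topDegree (λ r → cover cs r u [])
  cover-Vanishing cs len {u} supp u[]≡0 =
    Deg<-mono {f = λ r → cover cs r u []} (ℕ.m∸n≤m degree (suc k ℕ.* 0)) (preserves L (Supported⇒Fil supp) []) ,
    trans (cover-0 cs len supp []) u[]≡0
    where
    le : length cs ℕ.+ 0 ℕ.≤ suc k
    le = subst (ℕ._≤ suc k) (sym (trans (ℕ.+-identityʳ _) len)) (ℕ.n≤1+n k)
    L : Lowers 0 (cover cs)
    L = Lowers-∘ (Lowers-act≤ ℕ.z≤n (off base)) (Lowers-∘ (Lowers-detour cs 0 le) (Lowers-act≤ ℕ.z≤n (on base)))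

-- Ramsey's theorem

module _ {A : Set} (colour : A → ℕ) where

  separate : ∀ c xs → ∃[ ys ] ∃[ zs ] ys ⊆ xs × zs ⊆ xs × length ys ℕ.+ length zs ≡ length xs ×
             All (λ x → colour x ≡ c) ys × All (λ x → colour x ≢ c) zs
  separate c []       = [] , [] , [] , [] , refl , [] , []
  separate c (x ∷ xs) with separate c xs | colour x ℕ.≟ c
  ... | ys , zs , p , q , len , Y , Z | yes eq = x ∷ ys , zs , refl ∷ p , x ∷ʳ q , cong suc len , eq ∷ Y , Z
  ... | ys , zs , p , q , len , Y , Z | no neq = ys , x ∷ zs , x ∷ʳ p , refl ∷ q ,
    trans (ℕ.+-suc (length ys) (length zs)) (cong suc len) , Y , neq ∷ Z

  -- If fewer than `L` entries have the last colour, more than `q * L` entries remain for the other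
  -- `q` colours.
  monochromatic : ∀ q L xs → All (λ x → colour x ℕ.< q) xs → q ℕ.* L ℕ.< length xs →
                  ∃[ c ] ∃[ ys ] ys ⊆ xs × L ℕ.≤ length ys × All (λ x → colour x ≡ c) ys
  monochromatic zero    L (x ∷ xs) (() ∷ _) _
  monochromatic (suc q) L xs <q large with separate q xs
  ... | ys , zs , p , q′ , len , Y , Z with L ℕ.≤? length ys
  ... | yes L≤ = q , ys , p , L≤ , Y
  ... | no L≰ with monochromatic q L zs
            (All.zipWith (λ (lt , neq) → ℕ.≤∧≢⇒< (ℕ.s≤s⁻¹ lt) neq) (All-resp-⊆ q′ <q , Z))
            (ℕ.+-cancelˡ-< L (q ℕ.* L) (length zs) (ℕ.<-≤-trans large
              (ℕ.≤-trans (ℕ.≤-reflexive (sym len)) (ℕ.+-monoˡ-≤ (length zs) (ℕ.<⇒≤ (ℕ.≰⇒> L≰))))))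
  ... | c , us , r , L≤ , U = c , us , ⊆-trans r q′ , L≤ , U

module _ {A : Set} {q : ℕ} where

  -- Sublists of length `j` play the role of `j`-element subsets.
  Homogeneous : ℕ → (List A → Fin q) → List A → Fin q → Set
  Homogeneous j χ xs c = ∀ us → us ⊆ xs → length us ≡ j → χ us ≡ c

  -- Each entry comes with the common colour of the (1+j)-sets of which it is the first element.
  data EndHomogeneous (j : ℕ) (χ : List A → Fin q) : List (A × Fin q) → Set where
    []  : EndHomogeneous j χ []
    _∷_ : ∀ {x c zs} → Homogeneous j (χ ∘ (x ∷_)) (map proj₁ zs) c →
          EndHomogeneous j χ zs → EndHomogeneous j χ ((x , c) ∷ zs)

  EndHomogeneous-⊆ : ∀ {j χ ys zs} → ys ⊆ zs → EndHomogeneous j χ zs → EndHomogeneous j χ ys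
  EndHomogeneous-⊆ []         []      = []
  EndHomogeneous-⊆ (_ ∷ʳ p)   (_ ∷ E) = EndHomogeneous-⊆ p E
  EndHomogeneous-⊆ (refl ∷ p) (h ∷ E) = (λ us us⊆ → h us (⊆-trans us⊆ (map⁺ proj₁ p))) ∷ EndHomogeneous-⊆ p E

  endHomogeneous⇒homogeneous : ∀ {j χ zs c} → EndHomogeneous j χ zs → All (λ z → proj₂ z ≡ c) zs →
                               Homogeneous (suc j) χ (map proj₁ zs) c
  endHomogeneous⇒homogeneous []      []         [] []         ()
  endHomogeneous⇒homogeneous (_ ∷ E) (_ ∷ C)    us       (_ ∷ʳ p)   len = endHomogeneous⇒homogeneous E C us p len
  endHomogeneous⇒homogeneous (h ∷ E) (refl ∷ C) (u ∷ us) (refl ∷ p) len = h us p (ℕ.suc-injective len)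

-- Induction on `j`: fixing a first entry gives a colouring of `j`-sets, which leads to an
-- end-homogeneous list of `q * L + 1` entries; by pigeonhole at least `L` of the recorded colours
-- agree.
ramsey : ∀ {A : Set} j q L → ∃[ N ] ∀ (χ : List A → Fin q) xs → N ℕ.≤ length xs →
         ∃[ ys ] ys ⊆ xs × L ℕ.≤ length ys × ∃[ c ] Homogeneous j χ ys c
ramsey zero q L = L , λ χ xs le → xs , ⊆-refl , le , χ [] , λ { [] _ _ → refl }
ramsey {A} (suc j) q L = N , λ χ xs le →
    let (zs , zs⊆ , len , E)     = proj₂ (end M) χ xs le
        (c , ys , ys⊆ , L≤ , C) = monochromatic (toℕ ∘ proj₂) q L zs
          (All.tabulate (λ {z} _ → Fin.toℕ<n (proj₂ z))) (ℕ.≤-reflexive (sym len))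
    in result χ xs zs⊆ ys ys⊆ L≤ E C
  where
  end : ∀ M → ∃[ N ] ∀ (χ : List A → Fin q) xs → N ℕ.≤ length xs →
        ∃[ zs ] map proj₁ zs ⊆ xs × length zs ≡ M × EndHomogeneous j χ zs
  end zero    = 0 , λ χ xs _ → [] , minimum xs , refl , []
  end (suc M) = suc (proj₁ (ramsey {A} j q (proj₁ (end M)))) , λ
    { χ (x ∷ xs) (ℕ.s≤s le) →
      let (ys , ys⊆ , N≤ , c , h) = proj₂ (ramsey j q (proj₁ (end M))) (χ ∘ (x ∷_)) xs le
          (zs , zs⊆ , len , E)    = proj₂ (end M) χ ys N≤
      in (x , c) ∷ zs , refl ∷ ⊆-trans zs⊆ ys⊆ , cong suc len , (λ us us⊆ → h us (⊆-trans us⊆ zs⊆)) ∷ E }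
  M = suc (q ℕ.* L)
  N = proj₁ (end M)
  result : ∀ χ xs {zs} → map proj₁ zs ⊆ xs → ∀ ys → ys ⊆ zs → L ℕ.≤ length ys →
           EndHomogeneous j χ zs → ∀ {c} → All (λ z → toℕ (proj₂ z) ≡ c) ys →
           ∃[ us ] us ⊆ xs × L ℕ.≤ length us × ∃[ c ] Homogeneous (suc j) χ us c
  -- This happens for `L = 0` only. Any colour serves, as the empty list has no sublists of positive
  -- length.
  result χ xs zs⊆ []            ys⊆ L≤ E C = [] , ⊆-trans (map⁺ proj₁ ys⊆) zs⊆ , L≤ , χ [] , λ { .[] [] () }
  result χ xs zs⊆ ys@(y ∷ _) ys⊆ L≤ E (eq ∷ C) = map proj₁ ys , ⊆-trans (map⁺ proj₁ ys⊆) zs⊆ ,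
    subst (L ℕ.≤_) (sym (List.length-map proj₁ ys)) L≤ , proj₂ y ,
    endHomogeneous⇒homogeneous (EndHomogeneous-⊆ ys⊆ E)
      (refl ∷ All.map (λ eq′ → Fin.toℕ-injective (trans eq′ (sym eq))) C)

-- Homogeneity passes to sublists, so the colourings can be treated one after another, each leaving
-- enough entries for the rest.
simultaneousRamsey : ∀ {A I : Set} (arity : I → ℕ) (is : List I) q L →
  ∃[ N ] ∀ (χ : I → List A → Fin q) xs → N ℕ.≤ length xs →
  ∃[ ys ] ys ⊆ xs × L ℕ.≤ length ys × ∀ {i} → i ∈ is → ∃[ c ] Homogeneous (arity i) (χ i) ys c
simultaneousRamsey arity []       q L = L , λ χ xs le → xs , ⊆-refl , le , λ ()
simultaneousRamsey {A} arity (i ∷ is) q L =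
  let (N , rest) = simultaneousRamsey {A} arity is q L
      (N′ , one) = ramsey {A} (arity i) q N
  in N′ , λ χ xs le →
    let (ys , ys⊆ , N≤ , c , h)  = one (χ i) xs le
        (zs , zs⊆ , L≤ , H)      = rest χ ys N≤
    in zs , ⊆-trans zs⊆ ys⊆ , L≤ , λ
      { (here refl) → c , λ us us⊆ → h us (⊆-trans us⊆ zs⊆)
      ; (there i∈)  → H i∈ }

-- Values of a polynomial along a covering word

module Polynomial = Degree {ℚ} {ℚ} (λ h x → x + h)

⅓ : ℚ
⅓ = + 1 / 3

module _ (ε : ℚ) (0<ε : 0ℚ ℚ.< ε) where

  -- An event expresses a value of `P` by at most three terms, each of which receives a third of the
  -- error.
  radius : ℕ → ℚ
  radius zero    = ε
  radius (suc n) = ⅓ * radius n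

  radius-split : ∀ n → (radius (suc n) + radius (suc n)) + radius (suc n) ≡ radius n
  radius-split n = solve 1 (λ p → (con ⅓ :* p :+ con ⅓ :* p) :+ con ⅓ :* p := p) refl (radius n)

  radius-pos : ∀ n → 0ℚ ℚ.< radius n
  radius-pos zero    = 0<ε
  radius-pos (suc n) = subst (ℚ._< ⅓ * radius n) (ℚ.*-zeroʳ ⅓) (ℚ.*-monoʳ-<-pos ⅓ (radius-pos n))

  2radius≤ : ∀ n → radius (suc n) + radius (suc n) ℚ.≤ radius n
  2radius≤ n = begin
    ρ + ρ          ≡⟨ ℚ.+-identityʳ (ρ + ρ) ⟨
    ρ + ρ + 0ℚ     ≤⟨ ℚ.+-monoʳ-≤ (ρ + ρ) (ℚ.<⇒≤ (radius-pos (suc n))) ⟩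
    ρ + ρ + ρ      ≡⟨ radius-split n ⟩
    radius n       ∎
    where
    open ℚ.≤-Reasoning
    ρ = radius (suc n)

  radius-anti : ∀ {m n} → m ℕ.≤ n → radius n ℚ.≤ radius m
  radius-anti m≤n = go (ℕ.≤⇒≤′ m≤n)
    where
    step : ∀ n → radius (suc n) ℚ.≤ radius n
    step n = begin
      ρ              ≡⟨ ℚ.+-identityʳ ρ ⟨
      ρ + 0ℚ         ≤⟨ ℚ.+-monoʳ-≤ ρ (ℚ.<⇒≤ (radius-pos (suc n))) ⟩
      ρ + ρ          ≤⟨ 2radius≤ n ⟩
      radius n       ∎
      where
      open ℚ.≤-Reasoning
      ρ = radius (suc n)
    go : ∀ {m n} → m ℕ.≤′ n → radius n ℚ.≤ radius m
    go (ℕ.≤′-reflexive refl) = ℚ.≤-refl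
    go {m} {suc n} (ℕ.≤′-step m≤n) = ℚ.≤-trans (step n) (go m≤n)

maxBelow : (ℕ → ℕ) → ℕ → ℕ
maxBelow f zero    = 0
maxBelow f (suc n) = f n ℕ.⊔ maxBelow f n

≤-maxBelow : ∀ f {i n} → i ℕ.< n → f i ℕ.≤ maxBelow f n
≤-maxBelow f {i} {suc n} i<1+n with i ℕ.≟ n
... | yes refl = ℕ.m≤m⊔n (f n) (maxBelow f n)
... | no i≢n   = ℕ.≤-trans (≤-maxBelow f (ℕ.≤∧≢⇒< (ℕ.s≤s⁻¹ i<1+n) i≢n)) (ℕ.m≤n⊔m (f n) (maxBelow f n))

module Differences (k : ℕ) where
  open Words k
  open Detours k
  open Linear

  module _ (S : Track → ℕ → ℚ) where

    difference : Letter → ℕ → (ℚ → ℚ) → ℚ → ℚ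
    difference (first c)  t P x = P (x + S c t) - P x
    difference (second c) t P x = (P (x + S c t) - P x) - (P x - P (x - S c t))

    -- Letters and times are matched by position. The value 0 for missing times is a default that
    -- lists of equal length never meet.
    differences : List Letter → List ℕ → (ℚ → ℚ) → ℚ → ℚ
    differences []      ts       P   = P
    differences (l ∷ w) []       P x = 0ℚ
    differences (l ∷ w) (t ∷ ts) P   = differences w ts (difference l t P)

    Deg<-difference-first : ∀ c t n {P} → Polynomial.Deg< n P → Polynomial.Deg< (n ∸ 1) (difference (first c) t P)
    Deg<-difference-first c t zero    dP = Polynomial.Deg<-suc 0 dP (S c t)
    Deg<-difference-first c t (suc n) dP = dP (S c t)

    -- The centred second difference is the twofold first difference translated by `- S c t`.
    Deg<-difference-second : ∀ c t n {P} → Polynomial.Deg< n P → Polynomial.Deg< (n ∸ 2) (difference (second c) t P)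
    Deg<-difference-second c t n {P} dP = subst (λ m → Polynomial.Deg< m (difference (second c) t P)) (ℕ.∸-+-assoc n 1 1)
      (Polynomial.Deg<-cong (n ∸ 1 ∸ 1)
        (λ x → cong (λ y → (P (y + s) - P y) - (P y - P (x - s))) (solve 2 (λ x s → (x :- s) :+ s := x) refl x s))
        (Polynomial.Deg<-shift (n ∸ 1 ∸ 1) {difference (first c) t (difference (first c) t P)} (λ x → x - s)
          (λ h x → solve 3 (λ x h s → (x :+ h) :- s := (x :- s) :+ h) refl x h s)
          (Deg<-difference-first c t (n ∸ 1) (Deg<-difference-first c t n dP))))
      where s = S c t

    value : List Event → List ℕ → ℚ
    value (on c  ∷ W) (t ∷ ts) = S c t + value W ts
    value (off c ∷ W) (t ∷ ts) = - S c t + value W ts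
    value _           _        = 0ℚ

    Deg<-differences : ∀ w ts n {P} → Polynomial.Deg< n P → Polynomial.Deg< (n ∸ weight w) (differences w ts P)
    Deg<-differences []             ts       n dP = dP
    Deg<-differences (l ∷ w)        []       n dP = Polynomial.Deg<-0 (n ∸ weight (l ∷ w)) (λ _ → refl)
    Deg<-differences (first c ∷ w)  (t ∷ ts) n {P} dP =
      subst (λ m → Polynomial.Deg< m (differences w ts (difference (first c) t P))) (ℕ.∸-+-assoc n 1 (weight w))
        (Deg<-differences w ts (n ∸ 1) (Deg<-difference-first c t n dP))
    Deg<-differences (second c ∷ w) (t ∷ ts) n {P} dP =
      subst (λ m → Polynomial.Deg< m (differences w ts (difference (second c) t P))) (ℕ.∸-+-assoc n 2 (weight w))
        (Deg<-differences w ts (n ∸ 2) (Deg<-difference-second c t n dP))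

    differences≡0 : ∀ w ts n {P} → Polynomial.Deg< n P → n ℕ.≤ weight w → ∀ x → differences w ts P x ≡ 0ℚ
    differences≡0 w ts n {P} dP n≤ = subst (λ m → Polynomial.Deg< m (differences w ts P)) (ℕ.m≤n⇒m∸n≡0 n≤)
      (Deg<-differences w ts n dP)

    module _ {ε} (0<ε : 0ℚ ℚ.< ε) where

      ρ : ℕ → ℚ
      ρ = radius ε 0<ε

      -- The first event replaces `P` by `P` and its differences at time `t`, and `u` by the
      -- matching tails. Words that use this event get `t` as their first time, the others use later
      -- times only, as the sublist hypothesis allows.
      value≈run : ∀ W n ts P u → length W ℕ.≤ length ts →
        (∀ w us → us ⊆ ts → length us ≡ length w → Near (ρ (n ℕ.+ length W)) (differences w us P 0ℚ - u w)) →
        Near (ρ n) (P (value W ts) - run W u [])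
      value≈run []          n ts       P u _          H =
        subst (λ m → Near (ρ m) (P 0ℚ - u [])) (ℕ.+-identityʳ n) (H [] [] (minimum ts) refl)
      value≈run (on c ∷ W)  n (t ∷ ts) P u (ℕ.s≤s le) H = Near-mono (2radius≤ ε 0<ε n)
        (subst (Near (ρ (suc n) + ρ (suc n)))
          (trans (solve 4 (λ p q a b → (p :- a) :+ ((q :- p) :- b) := q :- (a :+ b)) refl
                   (P v) (P (v + s)) (run W u []) (run W (λ w → u (first c ∷ w)) []))
            (cong₂ (λ x r → P x - r) (ℚ.+-comm v s) (sym (homo-+ (Linear-run W) u (λ w → u (first c ∷ w)) []))))
          (Near-+ (value≈run W (suc n) ts P u le λ w us us⊆ len → shrink (H w us (t ∷ʳ us⊆) len))
            (value≈run W (suc n) ts (difference (first c) t P) (λ w → u (first c ∷ w)) le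
              λ w us us⊆ len → shrink (H (first c ∷ w) (t ∷ us) (refl ∷ us⊆) (cong suc len)))))
        where
        s = S c t
        v = value W ts
        shrink : ∀ {x} → Near (ρ (n ℕ.+ suc (length W))) x → Near (ρ (suc n ℕ.+ length W)) x
        shrink {x} = subst (λ m → Near (ρ m) x) (ℕ.+-suc n (length W))
      value≈run (off c ∷ W) n (t ∷ ts) P u (ℕ.s≤s le) H =
        subst₂ Near (radius-split ε 0<ε n)
          (trans (solve 6 (λ p q m a b d → ((p :- a) :- ((q :- p) :- b)) :+ (((q :- p) :- (p :- m)) :- d) := m :- ((a :- b) :+ d)) refl
                   (P v) (P (v + s)) (P (v - s)) (run W u []) (run W (λ w → u (first c ∷ w)) []) (run W (λ w → u (second c ∷ w)) []))
            (cong₂ (λ x r → P x - r) (ℚ.+-comm v (- s))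
              (sym (trans (homo-+ (Linear-run W) (λ w → u w - u (first c ∷ w)) (λ w → u (second c ∷ w)) [])
                (cong (_+ run W (λ w → u (second c ∷ w)) []) (homo-- (Linear-run W) u (λ w → u (first c ∷ w)) []))))))
          (Near-+ (Near-- (value≈run W (suc n) ts P u le λ w us us⊆ len → shrink (H w us (t ∷ʳ us⊆) len))
            (value≈run W (suc n) ts (difference (first c) t P) (λ w → u (first c ∷ w)) le
              λ w us us⊆ len → shrink (H (first c ∷ w) (t ∷ us) (refl ∷ us⊆) (cong suc len))))
            (value≈run W (suc n) ts (difference (second c) t P) (λ w → u (second c ∷ w)) le
              λ w us us⊆ len → shrink (H (second c ∷ w) (t ∷ us) (refl ∷ us⊆) (cong suc len))))
        where
        s = S c t
        v = value W ts
        shrink : ∀ {x} → Near (ρ (n ℕ.+ suc (length W))) x → Near (ρ (suc n ℕ.+ length W)) x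
        shrink {x} = subst (λ m → Near (ρ m) x) (ℕ.+-suc n (length W))

  -- Choice of times by Ramsey's theorem

  letters : List Letter
  letters = map first (allFin (suc k)) ++ map second (allFin (suc k))

  ∈-letters : ∀ l → l ∈ letters
  ∈-letters (first c)  = ∈-++⁺ˡ (∈-map⁺ first (∈-allFin c))
  ∈-letters (second c) = ∈-++⁺ʳ (map first (allFin (suc k))) (∈-map⁺ second (∈-allFin c))

  -- Finitely many colourings suffice, since differences of order above `suc k` vanish.
  words : ℕ → List (List Letter)
  words zero    = [] ∷ []
  words (suc n) = [] ∷ cartesianProductWith _∷_ letters (words n)

  ∈-words : ∀ {n} w → length w ℕ.≤ n → w ∈ words n
  ∈-words {zero}  []      _          = here refl
  ∈-words {suc n} []      _          = here refl
  ∈-words {suc n} (l ∷ w) (ℕ.s≤s le) = there (∈-cartesianProductWith⁺ _∷_ (∈-letters l) (∈-words w le))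

  length≤weight : ∀ w → length w ℕ.≤ weight w
  length≤weight []             = ℕ.z≤n
  length≤weight (first _ ∷ w)  = ℕ.s≤s (length≤weight w)
  length≤weight (second _ ∷ w) = ℕ.s≤s (ℕ.≤-trans (length≤weight w) (ℕ.n≤1+n _))

  others : List Track
  others = map suc (allFin k)

  length-others : length others ≡ k
  length-others = trans (List.length-map suc (allFin k)) (List.length-tabulate (λ i → i))

  size : ℕ → ℕ
  size e = length (coverWord e others)

  module _ {S : Track → ℕ → ℚ} {P} (dP : Polynomial.Deg< (2 ℕ.+ k) P) (P0 : P 0ℚ ≡ 0ℚ)
           {m} .{{_ : ℕ.NonZero m}} {δ} (0≤δ : 0ℚ ℚ.≤ δ) (δm≡1 : δ * (+ m / 1) ≡ 1ℚ)
           {ys : List ℕ} (long : suc k ℕ.≤ length ys)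
           (hom : ∀ {w} → w ∈ words (suc k) →
                  ∃[ c ] Homogeneous (length w) (λ us → quantise m (differences S w us P 0ℚ)) ys c) where

    -- The initial times serve as representatives; by homogeneity every other choice from `ys` gives
    -- nearly the same values modulo 1.
    limit : Functional
    limit w = differences S w (take (length w) ys) P 0ℚ

    Supported-limit : Supported limit
    Supported-limit w lt = differences≡0 S w (take (length w) ys) (2 ℕ.+ k) dP lt 0ℚ

    near-limit : ∀ w us → us ⊆ ys → length us ≡ length w → Near δ (differences S w us P 0ℚ - limit w)
    near-limit w us us⊆ len with weight w ℕ.≤? suc k
    ... | no ≰ = Near-∣∣ (subst (ℚ._≤ δ)
      (sym (cong ∣_∣ (cong₂ _-_ (differences≡0 S w us (2 ℕ.+ k) dP (ℕ.≰⇒> ≰) 0ℚ) (Supported-limit w (ℕ.≰⇒> ≰))))) 0≤δ)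
    ... | yes le = quantise-≡ (differences S w us P 0ℚ) (limit w) m 0≤δ δm≡1
        (trans (h us us⊆ len) (sym (h (take (length w) ys) (Sublist.take-Sublist (length w) ⊆-refl) len′)))
      where
      h = proj₂ (hom (∈-words w (ℕ.≤-trans (length≤weight w) le)))
      len′ : length (take (length w) ys) ≡ length w
      len′ = trans (List.length-take (length w) ys) (ℕ.m≤n⇒m⊓n≡m
        (ℕ.≤-trans (ℕ.≤-trans (length≤weight w) le) long))

    near-run : ∀ {ε} (0<ε : 0ℚ ℚ.< ε) W → δ ℚ.≤ radius ε 0<ε (length W) → length W ℕ.≤ length ys →
               Near ε (run W limit []) → Near (ε + ε) (P (value S W (take (length W) ys)))
    near-run {ε} 0<ε W δ≤ le near-Q = subst (Near (ε + ε))
      (solve 2 (λ a b → (a :- b) :+ b := a) refl (P (value S W ts)) (run W limit []))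
      (Near-+ close near-Q)
      where
      ts = take (length W) ys
      close : Near ε (P (value S W ts) - run W limit [])
      close = value≈run S 0<ε W 0 ts P limit
        (ℕ.≤-reflexive (sym (trans (List.length-take (length W) ys) (ℕ.m≤n⇒m⊓n≡m le))))
        λ w us us⊆ len → Near-mono δ≤
          (near-limit w us (⊆-trans us⊆ (Sublist.take-Sublist (length W) ⊆-refl)) len)

  -- `N` must not depend on `S` and `P`: the accuracy of the rational approximation `P` is chosen
  -- after `N`.
  AlmostIntegral : ℚ → ℕ → Set
  AlmostIntegral ε N = ∀ S P → Polynomial.Deg< (2 ℕ.+ k) P → P 0ℚ ≡ 0ℚ → ∀ xs → N ℕ.≤ length xs →
    ∃[ e ] ∃[ ts ] ts ⊆ xs × length ts ≡ size e × Near ε (P (value S (coverWord e others) ts))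

  module _ {ε} (0<ε : 0ℚ ℚ.< ε) where

    private
      0<½ε : 0ℚ ℚ.< ½ * ε
      0<½ε = ½-pos 0<ε

      Recurs : ℕ → Set
      Recurs R = ∀ (Q : Fin 1 → ℕ → ℚ) → (∀ a → Vanishing topDegree (Q a)) →
        ∃[ r ] 1 ℕ.≤ r × r ℕ.≤ R × ∀ a → Near (½ * ε) (Q a r)

    module _ {R} (rec : Recurs R) {L} (size≤L : ∀ {e} → e ℕ.< R → size e ℕ.≤ L) (k<L : suc k ℕ.≤ L)
             {m} .{{_ : ℕ.NonZero m}} {δ} (0≤δ : 0ℚ ℚ.≤ δ) (δ≤ : δ ℚ.≤ radius (½ * ε) 0<½ε L) (δm≡1 : δ * (+ m / 1) ≡ 1ℚ)
             {S P} (dP : Polynomial.Deg< (2 ℕ.+ k) P) (P0 : P 0ℚ ≡ 0ℚ)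
             {ys : List ℕ} (L≤ : L ℕ.≤ length ys)
             (hom : ∀ {w} → w ∈ words (suc k) →
                    ∃[ c ] Homogeneous (length w) (λ us → quantise m (differences S w us P 0ℚ)) ys c) where

      almostIntegral-on : ∃[ e ] size e ℕ.≤ length ys ×
                          Near ε (P (value S (coverWord e others) (take (size e) ys)))
      almostIntegral-on = answer (rec (λ _ → Q) (λ _ → cover-Vanishing others length-others supp P0))
        where
        long = ℕ.≤-trans k<L L≤
        κ : Functional
        κ = limit dP P0 0≤δ δm≡1 long hom
        supp : Supported κ
        supp = Supported-limit dP P0 0≤δ δm≡1 long hom
        Q : ℕ → ℚ
        Q r = cover others r κ []
        answer : ∃[ r ] 1 ℕ.≤ r × r ℕ.≤ R × (∀ (a : Fin 1) → Near (½ * ε) (Q r)) →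
                 ∃[ e ] size e ℕ.≤ length ys ×
                 Near ε (P (value S (coverWord e others) (take (size e) ys)))
        answer (suc e , _ , e<R , near-Q) = e , size≤ys ,
            subst (λ η → Near η (P (value S (coverWord e others) (take (size e) ys)))) (½-split ε)
              (near-run dP P0 0≤δ δm≡1 long hom 0<½ε (coverWord e others)
                (ℚ.≤-trans δ≤ (radius-anti (½ * ε) 0<½ε (size≤L e<R))) size≤ys
                (subst (Near (½ * ε)) (cover-run others e (ℕ.≤-reflexive length-others) supp []) (near-Q zero)))
          where
          size≤ys : size e ℕ.≤ length ys
          size≤ys = ℕ.≤-trans (size≤L e<R) L≤

    almostIntegral : ∃[ N ] AlmostIntegral ε N
    almostIntegral = withRecurrence (recurrence topDegree 1 (½ * ε) 0<½ε)
      where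
      Boxes : ℚ → Set
      Boxes ρ = ∃[ m ] ∃[ δ ] 0ℚ ℚ.≤ δ × δ ℚ.≤ ρ × δ * (+ suc m / 1) ≡ 1ℚ
      withRecurrence : ∃[ R ] Recurs R → ∃[ N ] AlmostIntegral ε N
      withRecurrence (R , rec) = withBoxes (boxes (radius-pos (½ * ε) 0<½ε L))
        where
        L : ℕ
        -- Enough times for every covering word with `e < R` and for all letter words of length at
        -- most `suc k`.
        L = maxBelow size R ℕ.⊔ suc k
        size≤L : ∀ {e} → e ℕ.< R → size e ℕ.≤ L
        size≤L e<R = ℕ.≤-trans (≤-maxBelow size e<R) (ℕ.m≤m⊔n (maxBelow size R) (suc k))
        withBoxes : Boxes (radius (½ * ε) 0<½ε L) → ∃[ N ] AlmostIntegral ε N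
        withBoxes (m , δ , 0≤δ , δ≤ , δm≡1) = withRamsey (simultaneousRamsey length (words (suc k)) (suc m) L)
          where
          Ramsey : ℕ → Set
          Ramsey N = ∀ (χ : List Letter → List ℕ → Fin (suc m)) xs → N ℕ.≤ length xs →
            ∃[ ys ] ys ⊆ xs × L ℕ.≤ length ys ×
            (∀ {w} → w ∈ words (suc k) → ∃[ c ] Homogeneous (length w) (χ w) ys c)
          withRamsey : ∃[ N ] Ramsey N → ∃[ N ] AlmostIntegral ε N
          withRamsey (N , ram) = N , λ S P dP P0 xs N≤ →
            let (ys , ys⊆ , L≤ , hom) = ram (λ w us → quantise (suc m) (differences S w us P 0ℚ)) xs N≤
                (e , size≤ , integral) = almostIntegral-on rec size≤L (ℕ.m≤n⊔m (maxBelow size R) (suc k))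
                                          0≤δ δ≤ δm≡1 dP P0 L≤ hom
            in e , take (size e) ys , ⊆-trans (Sublist.take-Sublist (size e) ⊆-refl) ys⊆ ,
               trans (List.length-take (size e) ys) (ℕ.m≤n⇒m⊓n≡m size≤) , integral

-- From covering words to sets with bounded gaps

≤ᵇ-true : ∀ {m n} → m ℕ.≤ n → (m ≤ᵇ n) ≡ true
≤ᵇ-true {m} {n} le = dec-true (m ℕ.≤? n) le

≤ᵇ-false : ∀ {m n} → n ℕ.< m → (m ≤ᵇ n) ≡ false
≤ᵇ-false {m} {n} lt = dec-false (m ℕ.≤? n) (ℕ.<⇒≱ lt)

module Covering (k : ℕ) where
  open Words k
  open Detours k
  open Differences k

  -- States of the tracks and guarded words

  State : Set
  State = Track → Bool

  _[_≔_] : State → Track → Bool → State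
  (σ [ c ≔ b ]) c′ = if does (c Fin.≟ c′) then b else σ c′

  ≔-same : ∀ σ c b → (σ [ c ≔ b ]) c ≡ b
  ≔-same σ c b rewrite dec-true (c Fin.≟ c) refl = refl

  ≔-other : ∀ σ {c c′} b → c ≢ c′ → (σ [ c ≔ b ]) c′ ≡ σ c′
  ≔-other σ {c} {c′} b c≢c′ rewrite dec-false (c Fin.≟ c′) c≢c′ = refl

  ≔-cong : ∀ {σ τ} c b → σ ≗ τ → σ [ c ≔ b ] ≗ τ [ c ≔ b ]
  ≔-cong c b σ≗τ c′ with does (c Fin.≟ c′)
  ... | true  = refl
  ... | false = σ≗τ c′

  ≔-restore : ∀ σ c b b′ → σ c ≡ b′ → (σ [ c ≔ b ]) [ c ≔ b′ ] ≗ σ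
  ≔-restore σ c b b′ σc c′ with c Fin.≟ c′
  ... | yes refl = sym σc
  ... | no  _    = refl

  -- `c′` is a track that is on both before and after the event; only the final event leaves all
  -- tracks off.
  data Guarded (σ : State) : List Event → Set where
    last    : ∀ {c} → σ c ≡ true → (∀ {c′} → c ≢ c′ → σ c′ ≡ false) → Guarded σ (off c ∷ [])
    turnOn  : ∀ {c c′ W} → σ c ≡ false → c ≢ c′ → σ c′ ≡ true →
              Guarded (σ [ c ≔ true ]) W → Guarded σ (on c ∷ W)
    turnOff : ∀ {c c′ W} → σ c ≡ true → c ≢ c′ → σ c′ ≡ true →
              Guarded (σ [ c ≔ false ]) W → Guarded σ (off c ∷ W)

  Guarded-cong : ∀ {σ τ W} → σ ≗ τ → Guarded σ W → Guarded τ W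
  Guarded-cong σ≗τ (last {c} p q) = last (trans (sym (σ≗τ _)) p) (λ c≢ → trans (sym (σ≗τ _)) (q c≢))
  Guarded-cong σ≗τ (turnOn {c} p q r G) =
    turnOn (trans (sym (σ≗τ _)) p) q (trans (sym (σ≗τ _)) r) (Guarded-cong (≔-cong c true σ≗τ) G)
  Guarded-cong σ≗τ (turnOff {c} p q r G) =
    turnOff (trans (sym (σ≗τ _)) p) q (trans (sym (σ≗τ _)) r) (Guarded-cong (≔-cong c false σ≗τ) G)

  -- `V` is guarded from `σ` and leads back to `σ`; the form with a continuation makes such words
  -- compose.
  Prependable : State → List Event → Set
  Prependable σ V = ∀ {W} → Guarded σ W → Guarded σ (V ++ W)

  Prependable-repeat : ∀ {σ} e {V} → Prependable σ V → Prependable σ (repeat e V)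
  Prependable-repeat zero    pre     G = G
  Prependable-repeat (suc e) {V} pre {W} G = subst (Guarded _) (sym (List.++-assoc (repeat e V) V W))
    (Prependable-repeat e pre (pre G))

  -- `c` is switched only while `base` is on, and the inner loops, which switch `base`, run only
  -- while `c` is on; so another track survives every event.
  Prependable-detour : ∀ cs e {σ} → Unique cs → All (λ c → base ≢ c) cs → σ base ≡ true → All (λ c → σ c ≡ false) cs →
                       Prependable σ (detourWord e cs)
  Prependable-detour []       e     uniq         ≢base         onBase offs          G = G
  Prependable-detour (c ∷ cs) e {σ} (c∉ ∷ uniq) (base≢c ∷ ≢base) onBase (offc ∷ offs) {W} G =
    subst (Guarded σ) (sym (List.++-assoc X (on c ∷ Y ++ off c ∷ Z) W))
      (Prependable-detour cs e uniq ≢base onBase offs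
        (turnOn offc (base≢c ∘ sym) onBase
          (subst (Guarded σ₁) (sym (List.++-assoc Y (off c ∷ Z) W))
            (Prependable-repeat e loop-pre
              (turnOff onc₁ (base≢c ∘ sym) onBase₁
                (Guarded-cong (λ c′ → sym (≔-restore σ c true false offc c′))
                  (Prependable-repeat e pulse-pre G)))))))
    where
    X = detourWord e cs
    Y = repeat e (loopWord e cs)
    Z = repeat e (on c ∷ off c ∷ [])
    σ₁ = σ [ c ≔ true ]
    onc₁ : σ₁ c ≡ true
    onc₁ = ≔-same σ c true
    onBase₁ : σ₁ base ≡ true
    onBase₁ = trans (≔-other σ true (base≢c ∘ sym)) onBase
    loop-pre : Prependable σ₁ (loopWord e cs)
    loop-pre G = turnOff onBase₁ base≢c onc₁
      (turnOn (≔-same σ₁ base false) base≢c (trans (≔-other σ₁ false base≢c) onc₁)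
        (Guarded-cong (λ c′ → sym (≔-restore σ₁ base false true onBase₁ c′))
          (Prependable-detour cs e uniq ≢base onBase₁
            (All.zipWith (λ (c≢ , offc′) → trans (≔-other σ true c≢) offc′) (c∉ , offs)) G)))
    pulse-pre : Prependable σ (on c ∷ off c ∷ [])
    pulse-pre G = turnOn offc (base≢c ∘ sym) onBase
      (turnOff onc₁ (base≢c ∘ sym) onBase₁ (Guarded-cong (λ c′ → sym (≔-restore σ c true false offc c′)) G))

  ∅ : State
  ∅ _ = false

  Unique-others : Unique others
  Unique-others = AllPairs.map⁺ (AllPairs.tabulate⁺ (λ i≢j eq → i≢j (Fin.suc-injective eq)))

  Guarded-cover : ∀ e → Guarded (∅ [ base ≔ true ]) (detourWord e others ++ off base ∷ [])
  Guarded-cover e = Prependable-detour others e Unique-others ≢base refl offs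
    (last refl (λ {c} ≢ → ≔-other ∅ true ≢))
    where
    ≢base : All (λ c → base ≢ c) others
    ≢base = All.map⁺ (All.tabulate (λ _ ()))
    offs : All (λ c → (∅ [ base ≔ true ]) c ≡ false) others
    offs = All.map⁺ (All.tabulate (λ _ → refl))

  step : State → Event → State
  step σ (on c)  = σ [ c ≔ true ]
  step σ (off c) = σ [ c ≔ false ]

  state : State → List Event → List ℕ → ℕ → State
  state σ (a ∷ W) (t ∷ ts) b = if t ≤ᵇ b then state (step σ a) W ts b else σ
  state σ _       _        b = σ

  state-before : ∀ σ W {ts b} → All (b ℕ.<_) ts → state σ W ts b ≡ σ
  state-before σ []      _                   = refl
  state-before σ (a ∷ W) []                  = refl
  state-before σ (a ∷ W) (b<t ∷ _) rewrite ≤ᵇ-false b<t = refl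

  state-after : ∀ σ a W {t ts b} → t ℕ.≤ b → state σ (a ∷ W) (t ∷ ts) b ≡ state (step σ a) W ts b
  state-after σ a W t≤b rewrite ≤ᵇ-true t≤b = refl

  off-all : ∀ {σ c} → (∀ {c′} → c ≢ c′ → σ c′ ≡ false) → ∀ c′ → (σ [ c ≔ false ]) c′ ≡ false
  off-all {c = c} q c′ with c Fin.≟ c′
  ... | yes _   = refl
  ... | no c≢c′ = q c≢c′

  step-survive : ∀ {σ a W} → Guarded σ (a ∷ W) → (W ≡ [] × ∀ c → step σ a c ≡ false) ⊎
                 ∃[ c ] σ c ≡ true × step σ a c ≡ true
  step-survive (last p q) = inj₁ (refl , off-all q)
  step-survive {σ} (turnOn  {c′ = c′} p q r G) = inj₂ (c′ , r , trans (≔-other σ true q) r)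
  step-survive {σ} (turnOff {c′ = c′} p q r G) = inj₂ (c′ , r , trans (≔-other σ false q) r)

  nonempty : ∀ {σ a W} → Guarded σ (a ∷ W) → ∃[ c ] σ c ≡ true
  nonempty (last p q)        = _ , p
  nonempty (turnOn p q r G)  = _ , r
  nonempty (turnOff p q r G) = _ , p

  Increasing : List ℕ → Set
  Increasing = AllPairs ℕ._<_

  -- Times increase strictly, so at most one event falls on `suc b`, and guardedness supplies a
  -- track that survives it. The track on at `b′` excludes that this event was the last.
  persistence : ∀ {σ W ts} → Guarded σ W → Increasing ts → length W ≡ length ts →
    ∀ b b′ {c} → b ℕ.< b′ → state σ W ts b′ c ≡ true →
    ∃[ c′ ] state σ W ts b c′ ≡ true × state σ W ts (suc b) c′ ≡ true
  persistence {σ} {a ∷ W} {t ∷ ts} G (t< ∷ inc) len b b′ {c} b<b′ st with t ℕ.≤? b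
  ... | yes t≤b = recurse G
      (trans (cong (λ f → f c) (sym (state-after σ a W (ℕ.≤-trans t≤b (ℕ.<⇒≤ b<b′))))) st)
    where
    Goal : Set
    Goal = ∃[ c′ ] state σ (a ∷ W) (t ∷ ts) b c′ ≡ true × state σ (a ∷ W) (t ∷ ts) (suc b) c′ ≡ true
    lift : (∃[ c′ ] state (step σ a) W ts b c′ ≡ true × state (step σ a) W ts (suc b) c′ ≡ true) → Goal
    lift (c′ , p , q) = c′ , trans (cong (λ f → f c′) (state-after σ a W t≤b)) p ,
      trans (cong (λ f → f c′) (state-after σ a W (ℕ.m≤n⇒m≤1+n t≤b))) q
    recurse : Guarded σ (a ∷ W) → state (step σ a) W ts b′ c ≡ true → Goal
    recurse (last _ q)          st = contradiction (trans (sym st) (off-all q c)) λ ()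
    recurse (turnOn _ _ _ G)    st = lift (persistence G inc (ℕ.suc-injective len) b b′ b<b′ st)
    recurse (turnOff _ _ _ G)   st = lift (persistence G inc (ℕ.suc-injective len) b b′ b<b′ st)
  ... | no t≰b with t ℕ.≤? suc b
  ... | no t≰1+b = let (c′ , p) = nonempty G in
    c′ , trans (cong (λ f → f c′) (state-before σ (a ∷ W) (before (ℕ.≰⇒> t≰b)))) p ,
         trans (cong (λ f → f c′) (state-before σ (a ∷ W) (before (ℕ.≰⇒> t≰1+b)))) p
    where
    before : ∀ {b} → b ℕ.< t → All (b ℕ.<_) (t ∷ ts)
    before b<t = b<t ∷ All.map (ℕ.<-trans b<t) t<
  ... | yes t≤1+b with step-survive G
  ... | inj₁ (refl , empty) = contradiction
    (trans (sym st) (trans (cong (λ f → f c) (state-after σ a [] {ts = ts} (ℕ.≤-trans t≤1+b b<b′))) (empty c))) λ ()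
  ... | inj₂ (c′ , p , q) =
    c′ , trans (cong (λ f → f c′) (state-before σ (a ∷ W) (b<t ∷ All.map (ℕ.<-trans b<t) t<))) p ,
         trans (cong (λ f → f c′) (trans (state-after σ a W t≤1+b)
           (state-before (step σ a) W (All.map (ℕ.≤-<-trans (ℕ.≰⇒> t≰b)) t<)))) q
    where b<t = ℕ.≰⇒> t≰b

  -- Every event really changes its track, so that the signed indicators of the events add up to the
  -- state.
  Toggles : State → List Event → Set
  Toggles σ []          = ⊤
  Toggles σ (on c ∷ W)  = σ c ≡ false × Toggles (σ [ c ≔ true ]) W
  Toggles σ (off c ∷ W) = σ c ≡ true × Toggles (σ [ c ≔ false ]) W

  Guarded⇒Toggles : ∀ {σ W} → Guarded σ W → Toggles σ W
  Guarded⇒Toggles (last p q)        = p , tt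
  Guarded⇒Toggles (turnOn p _ _ G)  = p , Guarded⇒Toggles G
  Guarded⇒Toggles (turnOff p _ _ G) = p , Guarded⇒Toggles G

  -- Sums over the set as signed sums of track tails

  ⟦_⟧ : Bool → ℚ
  ⟦ true ⟧  = 1ℚ
  ⟦ false ⟧ = 0ℚ

  sumOver : List ℕ → (ℕ → ℚ) → ℚ
  sumOver []       f = 0ℚ
  sumOver (q ∷ qs) f = f q + sumOver qs f

  sumOver-cong : ∀ qs {f g} → f ≗ g → sumOver qs f ≡ sumOver qs g
  sumOver-cong []       f≗g = refl
  sumOver-cong (q ∷ qs) f≗g = cong₂ _+_ (f≗g q) (sumOver-cong qs f≗g)

  sumOver-+ : ∀ qs f g → sumOver qs f + sumOver qs g ≡ sumOver qs (λ q → f q + g q)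
  sumOver-+ []       f g = refl
  sumOver-+ (q ∷ qs) f g = trans
    (solve 4 (λ a b c d → (a :+ b) :+ (c :+ d) := (a :+ c) :+ (b :+ d)) refl (f q) (sumOver qs f) (g q) (sumOver qs g))
    (cong (λ z → f q + g q + z) (sumOver-+ qs f g))

  sumOver-neg : ∀ qs f → - sumOver qs f ≡ sumOver qs (λ q → - f q)
  sumOver-neg []       f = refl
  sumOver-neg (q ∷ qs) f = trans (ℚ.neg-distrib-+ (f q) (sumOver qs f)) (cong (λ z → - f q + z) (sumOver-neg qs f))

  sumOver-0 : ∀ qs f → (∀ q → f q ≡ 0ℚ) → sumOver qs f ≡ 0ℚ
  sumOver-0 []       f f≡0 = refl
  sumOver-0 (q ∷ qs) f f≡0 = cong₂ _+_ (f≡0 q) (sumOver-0 qs f f≡0)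

  -- Positions start at 0 and stand for the positive integers `suc q`. They are cut into blocks of
  -- length `suc k`, numbered by time, with one position for each track.
  block : ℕ → ℕ
  block q = q ℕ./ suc k

  track : ℕ → Track
  track q = q mod suc k

  at : ℕ → Track → ℕ
  at b c = toℕ c ℕ.+ b ℕ.* suc k

  block-at : ∀ b c → block (at b c) ≡ b
  block-at b c = trans (+-distrib-/-∣ʳ (toℕ c) (divides-refl b))
    (cong₂ ℕ._+_ (m<n⇒m/n≡0 (Fin.toℕ<n c)) (m*n/n≡m b (suc k)))

  track-at : ∀ b c → track (at b c) ≡ c
  track-at b c = Fin.toℕ-injective (trans (Fin.toℕ-fromℕ< (m%n<n (at b c) (suc k)))
    (trans ([m+kn]%n≡m%n (toℕ c) b (suc k)) (m<n⇒m%n≡m (Fin.toℕ<n c))))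

  at-block-track : ∀ q → q ≡ at (block q) (track q)
  at-block-track q = trans (m≡m%n+[m/n]*n q (suc k))
    (cong (ℕ._+ block q ℕ.* suc k) (sym (Fin.toℕ-fromℕ< (m%n<n q (suc k)))))

  indicator : List Event → List ℕ → ℕ → ℚ
  indicator (on c  ∷ W) (t ∷ ts) q = ⟦ does (c Fin.≟ track q) ∧ (t ≤ᵇ block q) ⟧ + indicator W ts q
  indicator (off c ∷ W) (t ∷ ts) q = - ⟦ does (c Fin.≟ track q) ∧ (t ≤ᵇ block q) ⟧ + indicator W ts q
  indicator _           _        q = 0ℚ

  indicator-before : ∀ W {ts q} → All (block q ℕ.<_) ts → indicator W ts q ≡ 0ℚ
  indicator-before []          _                   = refl
  indicator-before (on c ∷ W)  []                  = refl
  indicator-before (off c ∷ W) []                  = refl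
  indicator-before (on c ∷ W) {t ∷ _} {q}  (b<t ∷ b<) rewrite ≤ᵇ-false b<t | Bool.∧-zeroʳ (does (c Fin.≟ track q)) =
    trans (ℚ.+-identityˡ _) (indicator-before W b<)
  indicator-before (off c ∷ W) {t ∷ _} {q} (b<t ∷ b<) rewrite ≤ᵇ-false b<t | Bool.∧-zeroʳ (does (c Fin.≟ track q)) =
    trans (ℚ.+-identityˡ _) (indicator-before W b<)

  state-indicator : ∀ σ W ts → Increasing ts → Toggles σ W → ∀ q →
    ⟦ state σ W ts (block q) (track q) ⟧ ≡ ⟦ σ (track q) ⟧ + indicator W ts q
  state-indicator σ []          ts       _            _       q = sym (ℚ.+-identityʳ _)
  state-indicator σ (on c ∷ W)  []       _            _       q = sym (ℚ.+-identityʳ _)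
  state-indicator σ (off c ∷ W) []       _            _       q = sym (ℚ.+-identityʳ _)
  state-indicator σ (on c ∷ W)  (t ∷ ts) (t< ∷ inc) (p , T) q with t ℕ.≤? block q
  ... | no t≰ rewrite ≤ᵇ-false (ℕ.≰⇒> t≰) | Bool.∧-zeroʳ (does (c Fin.≟ track q))
      | indicator-before W {ts} {q} (All.map (ℕ.<-trans (ℕ.≰⇒> t≰)) t<) = sym (ℚ.+-identityʳ _)
  ... | yes t≤ rewrite ≤ᵇ-true t≤ = trans (state-indicator (σ [ c ≔ true ]) W ts inc T q) (lemma (c Fin.≟ track q))
    where
    lemma : ∀ d → ⟦ if does d then true else σ (track q) ⟧ + indicator W ts q ≡
                  ⟦ σ (track q) ⟧ + (⟦ does d ∧ true ⟧ + indicator W ts q)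
    lemma (yes refl) rewrite p = sym (ℚ.+-identityˡ _)
    lemma (no _)               = cong (λ z → ⟦ σ (track q) ⟧ + z) (sym (ℚ.+-identityˡ _))
  state-indicator σ (off c ∷ W) (t ∷ ts) (t< ∷ inc) (p , T) q with t ℕ.≤? block q
  ... | no t≰ rewrite ≤ᵇ-false (ℕ.≰⇒> t≰) | Bool.∧-zeroʳ (does (c Fin.≟ track q))
      | indicator-before W {ts} {q} (All.map (ℕ.<-trans (ℕ.≰⇒> t≰)) t<) = sym (ℚ.+-identityʳ _)
  ... | yes t≤ rewrite ≤ᵇ-true t≤ = trans (state-indicator (σ [ c ≔ false ]) W ts inc T q) (lemma (c Fin.≟ track q))
    where
    lemma : ∀ d → ⟦ if does d then false else σ (track q) ⟧ + indicator W ts q ≡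
                  ⟦ σ (track q) ⟧ + (- ⟦ does d ∧ true ⟧ + indicator W ts q)
    lemma (yes refl) rewrite p = solve 1 (λ a → con 0ℚ :+ a := con 1ℚ :+ (:- con 1ℚ :+ a)) refl (indicator W ts q)
    lemma (no _)               = cong (λ z → ⟦ σ (track q) ⟧ + z) (sym (ℚ.+-identityˡ _))

  module _ (n : ℕ → ℕ) (N : ℕ) where

    qs : List ℕ
    qs = upTo (N ℕ.* suc k)

    summand : ℕ → ℚ
    summand q = + n (suc q) / 1

    -- The tails and the set are both cut off after `N` blocks, so that all identities concern
    -- finite sums.
    tailSum : Track → ℕ → ℚ
    tailSum c t = sumOver qs (λ q → ⟦ does (c Fin.≟ track q) ∧ (t ≤ᵇ block q) ⟧ * summand q)

    value-indicator : ∀ W ts → value tailSum W ts ≡ sumOver qs (λ q → indicator W ts q * summand q)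
    value-indicator []          ts       = sym (sumOver-0 qs _ (λ q → ℚ.*-zeroˡ (summand q)))
    value-indicator (on c ∷ W)  []       = sym (sumOver-0 qs _ (λ q → ℚ.*-zeroˡ (summand q)))
    value-indicator (off c ∷ W) []       = sym (sumOver-0 qs _ (λ q → ℚ.*-zeroˡ (summand q)))
    value-indicator (on c ∷ W)  (t ∷ ts) = trans (cong (λ z → tailSum c t + z) (value-indicator W ts))
      (trans (sumOver-+ qs _ _) (sumOver-cong qs (λ q → sym (ℚ.*-distribʳ-+ (summand q) ⟦ does (c Fin.≟ track q) ∧ (t ≤ᵇ block q) ⟧ (indicator W ts q)))))
    value-indicator (off c ∷ W) (t ∷ ts) = trans (cong₂ _+_ (sumOver-neg qs _) (value-indicator W ts))
      (trans (sumOver-+ qs _ _) (sumOver-cong qs (λ q →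
        solve 3 (λ i j s → :- (i :* s) :+ j :* s := (:- i :+ j) :* s) refl
          ⟦ does (c Fin.≟ track q) ∧ (t ≤ᵇ block q) ⟧ (indicator W ts q) (summand q))))

    sum-filter : ∀ (mem : ℕ → Bool) qs → + sum (map n (map suc (filter (λ q → mem q Bool.≟ true) qs))) / 1 ≡
                 sumOver qs (λ q → ⟦ mem q ⟧ * summand q)
    sum-filter mem []       = refl
    sum-filter mem (q ∷ qs) with mem q
    ... | true  = trans (/1-homo-+ (+ n (suc q)) (+ sum (map n (map suc (filter (λ q → mem q Bool.≟ true) qs)))))
      (cong₂ _+_ (sym (ℚ.*-identityˡ (summand q))) (sum-filter mem qs))
    ... | false = trans (sum-filter mem qs) (sym (trans (cong (_+ sumOver qs (λ q → ⟦ mem q ⟧ * summand q)) (ℚ.*-zeroˡ (summand q))) (ℚ.+-identityˡ _)))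

    -- The set described by a covering word, and its gaps

    module _ (e : ℕ) {t : ℕ} {ts : List ℕ} (t<N : t ℕ.< N) (inc : Increasing (t ∷ ts))
             (len : length (t ∷ ts) ≡ size e) where

      private
        W W₁ : List Event
        W₁ = detourWord e others ++ off base ∷ []
        W  = on base ∷ W₁

        σ₁ : State
        σ₁ = ∅ [ base ≔ true ]

        present : ℕ → State
        present = state ∅ W (t ∷ ts)

        member : ℕ → Bool
        member q = present (block q) (track q)

        kept : List ℕ
        kept = filter (λ q → member q Bool.≟ true) qs

      ∈-kept : ∀ {b c} → b ℕ.< N → present b c ≡ true → suc (at b c) ∈ map ℕ.suc kept
      ∈-kept {b} {c} b<N pr = ∈-map⁺ ℕ.suc (∈-filter⁺ (λ q → member q Bool.≟ true) (∈-upTo⁺ at<)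
        (trans (cong₂ present (block-at b c) (track-at b c)) pr))
        where
        at< : at b c ℕ.< N ℕ.* suc k
        at< = ℕ.≤-trans (ℕ.+-monoˡ-≤ (b ℕ.* suc k) (Fin.toℕ<n c)) (ℕ.*-monoˡ-≤ (suc k) b<N)

      ∈-kept⁻ : ∀ {i} → i ∈ map ℕ.suc kept →
                ∃[ b ] ∃[ c ] i ≡ suc (at b c) × b ℕ.< N × present b c ≡ true
      ∈-kept⁻ i∈ with ∈-map⁻ ℕ.suc i∈
      ... | q , q∈ , refl with ∈-filter⁻ (λ q → member q Bool.≟ true) {xs = qs} q∈
      ... | q∈qs , mem = block q , track q , cong suc (at-block-track q) , m<n*o⇒m/o<n (∈-upTo⁻ q∈qs) , mem

      present-t : present t base ≡ true
      present-t = trans (cong (λ f → f base) (trans (state-after ∅ (on base) W₁ ℕ.≤-refl)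
        (state-before σ₁ W₁ (AllPairs.head inc)))) (≔-same ∅ base true)

      -- The initial `on base` starts from the empty state and is not guarded, so it is split off;
      -- nothing is present before its time `t`.
      shared : ∀ b b′ {c c′} → b ℕ.< b′ → present b c ≡ true → present b′ c′ ≡ true →
               ∃[ c″ ] present b c″ ≡ true × present (suc b) c″ ≡ true
      shared b b′ {c} {c′} b<b′ pr pr′ with t ℕ.≤? b
      ... | no t≰b = contradiction (trans (sym pr) (cong (λ f → f c)
            (state-before ∅ W (ℕ.≰⇒> t≰b ∷ All.map (ℕ.<-trans (ℕ.≰⇒> t≰b)) (AllPairs.head inc))))) λ ()
      ... | yes t≤b =
          let (c″ , p , q) = persistence (Guarded-cover e) (AllPairs.tail inc) (sym (ℕ.suc-injective len)) b b′ b<b′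
                (trans (cong (λ f → f c′) (sym (state-after ∅ (on base) W₁ (ℕ.≤-trans t≤b (ℕ.<⇒≤ b<b′))))) pr′)
          in c″ , trans (cong (λ f → f c″) (state-after ∅ (on base) W₁ t≤b)) p ,
                  trans (cong (λ f → f c″) (state-after ∅ (on base) W₁ (ℕ.m≤n⇒m≤1+n t≤b))) q

      coverSet : FinSet⁺
      coverSet = record
        { elements   = map ℕ.suc kept
        ; increasing = AllPairs⇒Linked (AllPairs.map⁺ (AllPairs.map ℕ.s≤s
            (AllPairs.filter⁺ (λ q → member q Bool.≟ true) (AllPairs.applyUpTo⁺₁ id (N ℕ.* suc k) λ i<j _ → i<j))))
        ; positive   = All.map⁺ (All.tabulate (λ _ → ℕ.s≤s ℕ.z≤n)) }

      start∈ : suc (at t base) ∈ elements coverSet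
      start∈ = ∈-kept t<N present-t

      maximum∈ : maximum coverSet ∈ elements coverSet
      maximum∈ with argmax-sel id 0 (elements coverSet)
      ... | inj₂ m∈  = m∈
      ... | inj₁ m≡0 = contradiction (subst (suc (at t base) ℕ.≤_) m≡0 (All.lookup (xs≤max 0 (elements coverSet)) start∈)) λ ()

      at-suc : ∀ b c → at (suc b) c ≡ at b c ℕ.+ suc k
      at-suc b c = trans (cong (toℕ c ℕ.+_) (ℕ.+-comm (suc k) (b ℕ.* suc k))) (sym (ℕ.+-assoc (toℕ c) _ _))

      at-same-block : ∀ b c c′ → at b c′ ℕ.≤ at b c ℕ.+ suc k
      at-same-block b c c′ = ℕ.≤-trans (ℕ.+-monoˡ-≤ (b ℕ.* suc k) (ℕ.<⇒≤ (Fin.toℕ<n c′)))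
        (ℕ.≤-trans (ℕ.≤-reflexive (ℕ.+-comm (suc k) (b ℕ.* suc k))) (ℕ.+-monoˡ-≤ (suc k) (ℕ.m≤n+m (b ℕ.* suc k) (toℕ c))))

      -- If the maximum lies in a later block, some track `c″` is present in the block of `i` and in
      -- the next. If `c < c″`, its position in the same block follows `i`; otherwise `c″ ≤ c`, and
      -- its position in the next block is at most `suc k` away.
      gaps : ∀ i → i ∈ elements coverSet →
        i ≡ maximum coverSet ⊎ (∃[ j ] j ∈ elements coverSet × i ℕ.< j × j ℕ.≤ i ℕ.+ suc k)
      gaps i i∈ with i ℕ.≟ maximum coverSet
      ... | yes i≡m = inj₁ i≡m
      ... | no  i≢m = inj₂ (next (∈-kept⁻ i∈) (∈-kept⁻ maximum∈))
        where
        i<m : i ℕ.< maximum coverSet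
        i<m = ℕ.≤∧≢⇒< (All.lookup (xs≤max 0 (elements coverSet)) i∈) i≢m
        Position : ℕ → Set
        Position i = ∃[ b ] ∃[ c ] i ≡ suc (at b c) × b ℕ.< N × present b c ≡ true
        next : Position i → Position (maximum coverSet) →
               ∃[ j ] j ∈ elements coverSet × i ℕ.< j × j ℕ.≤ i ℕ.+ suc k
        next (b , c , i≡ , b<N , pr) (b′ , c′ , m≡ , b′<N , pr′) with ℕ.<-cmp b b′
        ... | tri≈ _ refl _ = maximum coverSet , maximum∈ , i<m ,
              subst₂ ℕ._≤_ (sym m≡) (cong (ℕ._+ suc k) (sym i≡)) (ℕ.s≤s (at-same-block b c c′))
        ... | tri> _ _ b′<b = contradiction (subst₂ ℕ._<_ i≡ m≡ i<m) (ℕ.≤⇒≯ (ℕ.s≤s m≤i))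
              where
              m≤i : at b′ c′ ℕ.≤ at b c
              m≤i = ℕ.≤-trans (ℕ.+-monoˡ-≤ (b′ ℕ.* suc k) (ℕ.<⇒≤ (Fin.toℕ<n c′)))
                      (ℕ.≤-trans (ℕ.*-monoˡ-≤ (suc k) b′<b) (ℕ.m≤n+m (b ℕ.* suc k) (toℕ c)))
        ... | tri< b<b′ _ _ with shared b b′ b<b′ pr pr′
        ... | c″ , p , q with toℕ c ℕ.<? toℕ c″
        ... | yes c<c″ = suc (at b c″) , ∈-kept b<N p ,
              subst (ℕ._< suc (at b c″)) (sym i≡) (ℕ.s≤s (ℕ.+-monoˡ-< (b ℕ.* suc k) c<c″)) ,
              subst (λ i → suc (at b c″) ℕ.≤ i ℕ.+ suc k) (sym i≡) (ℕ.s≤s (at-same-block b c c″))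
        ... | no c≮c″ = suc (at (suc b) c″) , ∈-kept (ℕ.≤-<-trans b<b′ b′<N) q ,
              subst (ℕ._< suc (at (suc b) c″)) (sym i≡) (ℕ.s≤s (ℕ.<-≤-trans (ℕ.+-monoˡ-< (b ℕ.* suc k) (Fin.toℕ<n c))
                (ℕ.m≤n+m (suc b ℕ.* suc k) (toℕ c″)))) ,
              subst (λ i → suc (at (suc b) c″) ℕ.≤ i ℕ.+ suc k) (sym i≡) (ℕ.s≤s (ℕ.≤-trans
                (ℕ.≤-reflexive (at-suc b c″)) (ℕ.+-monoˡ-≤ (suc k) (ℕ.+-monoˡ-≤ (b ℕ.* suc k) (ℕ.≮⇒≥ c≮c″)))))

      coverSet-𝒮 : 𝒮 (suc k) coverSet
      coverSet-𝒮 = (λ eq → contradiction (subst (suc (at t base) ∈_) eq start∈) λ ()) , gaps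

      coverSet-sum : + (∑[ coverSet ] n) / 1 ≡ value tailSum (coverWord e others) (t ∷ ts)
      coverSet-sum = trans (sum-filter member qs) (trans
        (sumOver-cong qs (λ q → cong (_* summand q) (trans
          (state-indicator ∅ W (t ∷ ts) inc (refl , Guarded⇒Toggles (Guarded-cover e)) q) (ℚ.+-identityˡ (indicator W (t ∷ ts) q)))))
        (sym (value-indicator W (t ∷ ts))))

      -- This bounds the argument of the polynomial before the word and its times are known.
      coverSet-≤ : ∑[ coverSet ] n ℕ.≤ sum (map n (map ℕ.suc qs))
      coverSet-≤ = go qs
        where
        go : ∀ qs → sum (map n (map ℕ.suc (filter (λ q → member q Bool.≟ true) qs))) ℕ.≤ sum (map n (map ℕ.suc qs))
        go []       = ℕ.z≤n
        go (q ∷ qs) with member q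
        ... | true  = ℕ.+-monoʳ-≤ (n (suc q)) (go qs)
        ... | false = ℕ.≤-trans (go qs) (ℕ.m≤n+m _ (n (suc q)))

-- Real polynomials

AllPairs-resp-⊆ : ∀ {A : Set} {R : A → A → Set} {xs ys} → xs ⊆ ys → AllPairs R ys → AllPairs R xs
AllPairs-resp-⊆ []         []       = []
AllPairs-resp-⊆ (_ ∷ʳ p)   (_ ∷ rs) = AllPairs-resp-⊆ p rs
AllPairs-resp-⊆ (refl ∷ p) (r ∷ rs) = All-resp-⊆ p r ∷ AllPairs-resp-⊆ p rs

-- Leibniz rule: the difference is `h * f (x + h) + x * (f (x + h) - f x)`.
Deg<-var : ∀ n {f} → Polynomial.Deg< n f → Polynomial.Deg< (suc n) (λ x → x * f x)
Deg<-var zero    {f} df h x = cong₂ _-_ (trans (cong ((x + h) *_) (df (x + h))) (ℚ.*-zeroʳ (x + h)))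
                                        (trans (cong (x *_) (df x)) (ℚ.*-zeroʳ x))
Deg<-var (suc n) {f} df h = Polynomial.Deg<-cong (suc n)
  (λ x → solve 4 (λ x h a b → h :* b :+ x :* (b :- a) := (x :+ h) :* b :- x :* a) refl x h (f x) (f (x + h)))
  (Polynomial.Deg<-+ (suc n) {λ x → h * f (x + h)} {λ x → x * (f (x + h) - f x)}
    (Polynomial.Deg<-* (suc n) {λ x → f (x + h)} h (Polynomial.Deg<-shift (suc n) {f} (_+ h)
      (λ k x → solve 3 (λ x k h → (x :+ k) :+ h := (x :+ h) :+ k) refl x k h) df))
    (Deg<-var n (df h)))

evalℚ : List ℚ → ℚ → ℚ
evalℚ []      x = 0ℚ
evalℚ (a ∷ p) x = a + x * evalℚ p x

Deg<-evalℚ : ∀ n p → length p ≤ n → Polynomial.Deg< n (evalℚ p)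
Deg<-evalℚ n       []      _          = Polynomial.Deg<-0 n (λ _ → refl)
Deg<-evalℚ (suc n) (a ∷ p) (ℕ.s≤s le) =
  Polynomial.Deg<-+ (suc n) {λ _ → a} {λ x → x * evalℚ p x} (Polynomial.Deg<-const n a) (Deg<-var n (Deg<-evalℚ n p le))

coefficients : ℕ → Poly → List ℚ
coefficients K = map (λ a → seq a K)

seq-eval : ∀ p x K → seq (eval p x) K ≡ evalℚ (coefficients K p) (seq x K)
seq-eval []      x K = refl
seq-eval (a ∷ p) x K = cong (λ z → seq a K + seq x K * z) (seq-eval p x K)

*-small : ∀ q {ε} → 0ℚ ℚ.< ε → ∃[ δ ] 0ℚ ℚ.< δ × ∀ z → ∣ z ∣ ℚ.< δ → ∣ q * z ∣ ℚ.< ε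
*-small q {ε} 0<ε = δ , 0<δ , λ z z<δ → begin-strict
    ∣ q * z ∣        ≡⟨ ℚ.∣p*q∣≡∣p∣*∣q∣ q z ⟩
    ∣ q ∣ * ∣ z ∣    ≤⟨ ℚ.*-monoʳ-≤-nonNeg ∣ z ∣ {{ℚ.∣-∣-nonNeg z}} q≤B ⟩
    B * ∣ z ∣        <⟨ ℚ.*-monoʳ-<-pos B z<δ ⟩
    B * δ            ≡⟨ ℚ.*-assoc B (ℚ.1/ B) ε ⟨
    B * ℚ.1/ B * ε   ≡⟨ cong (_* ε) (ℚ.*-inverseʳ B) ⟩
    1ℚ * ε           ≡⟨ ℚ.*-identityˡ ε ⟩
    ε                ∎
  where
  open ℚ.≤-Reasoning
  B = 1ℚ + ∣ q ∣
  q≤B : ∣ q ∣ ℚ.≤ B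
  q≤B = subst (ℚ._≤ B) (ℚ.+-identityˡ ∣ q ∣) (ℚ.+-monoˡ-≤ ∣ q ∣ (ℚ.<⇒≤ (ℚ.positive⁻¹ 1ℚ)))
  instance
    B-pos : ℚ.Positive B
    B-pos = ℚ.positive (ℚ.<-≤-trans (ℚ.positive⁻¹ 1ℚ)
      (subst (ℚ._≤ B) (ℚ.+-identityʳ 1ℚ) (ℚ.+-monoʳ-≤ 1ℚ (ℚ.0≤∣p∣ q))))
    B-nz : ℚ.NonZero B
    B-nz = ℚ.pos⇒nonZero B
  δ = ℚ.1/ B * ε
  0<δ : 0ℚ ℚ.< δ
  0<δ = subst (ℚ._< δ) (ℚ.*-zeroʳ (ℚ.1/ B)) (ℚ.*-monoʳ-<-pos (ℚ.1/ B) {{ℚ.1/pos⇒pos B}} 0<ε)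

-- The high coefficients may be present in the list as reals that are only `≈ 0ℝ`, so the values
-- agree as limits, not termwise.
eval-take : ∀ m p q → (∀ j → m ≤ j → coeff p j ≈ 0ℝ) → eval p (fromℚ q) ≈ eval (take m p) (fromℚ q)
eval-take zero    []      q _    ε 0<ε = 0 , λ _ _ → 0<ε
eval-take (suc m) []      q _    ε 0<ε = 0 , λ _ _ → 0<ε
eval-take zero    (a ∷ p) q high ε 0<ε =
  let (δ , 0<δ , small) = *-small q (½-pos 0<ε)
      (M , hM)          = high 0 ℕ.z≤n (½ * ε) (½-pos 0<ε)
      (N , hN)          = eval-take zero p q (λ j _ → high (suc j) ℕ.z≤n) δ 0<δ
  in M ℕ.⊔ N , λ n le →
    let e = seq (eval p (fromℚ q)) n in begin-strict
    ∣ (seq a n + q * e) - 0ℚ ∣             ≡⟨ cong ∣_∣ (solve 3 (λ a q e → (a :+ q :* e) :- con 0ℚ := (a :- con 0ℚ) :+ q :* (e :- con 0ℚ)) refl (seq a n) q e) ⟩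
    ∣ (seq a n - 0ℚ) + q * (e - 0ℚ) ∣      ≤⟨ ℚ.∣p+q∣≤∣p∣+∣q∣ (seq a n - 0ℚ) (q * (e - 0ℚ)) ⟩
    ∣ seq a n - 0ℚ ∣ + ∣ q * (e - 0ℚ) ∣    <⟨ ℚ.+-mono-< (hM n (ℕ.m⊔n≤o⇒m≤o M N le)) (small (e - 0ℚ) (hN n (ℕ.m⊔n≤o⇒n≤o M N le))) ⟩
    ½ * ε + ½ * ε                          ≡⟨ ½-split ε ⟩
    ε                                      ∎
  where open ℚ.≤-Reasoning
eval-take (suc m) (a ∷ p) q high ε 0<ε =
  let (δ , 0<δ , small) = *-small q 0<ε
      (N , hN)          = eval-take m p q (λ j m≤j → high (suc j) (ℕ.s≤s m≤j)) δ 0<δ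
  in N , λ n le →
    let e = seq (eval p (fromℚ q)) n
        e′ = seq (eval (take m p) (fromℚ q)) n
    in subst (λ z → ∣ z ∣ ℚ.< ε)
         (solve 4 (λ a q e e′ → q :* (e :- e′) := (a :+ q :* e) :- (a :+ q :* e′)) refl (seq a n) q e e′)
         (small (e - e′) (hN n le))

module _ (k : ℕ) (p : Poly) (high : ∀ j → 2 ℕ.+ k ≤ j → coeff p j ≈ 0ℝ) (p0 : eval p 0ℝ ≈ 0ℝ) where

  -- All coefficients are read at one index `K`, large enough for the finitely many `x ≤ X`, and the
  -- constant term is subtracted to get `P 0ℚ ≡ 0ℚ`. The four errors are the Cauchy error at `x`,
  -- the truncations at `x` and at 0, and the value of `p` at 0.
  rationalise : ∀ θ → 0ℚ ℚ.< θ → ∀ X → ∃[ P ] Polynomial.Deg< (2 ℕ.+ k) P × P 0ℚ ≡ 0ℚ ×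
    ∃[ K ] ∀ x n → x ≤ X → K ≤ n → ∣ seq (eval p (fromℕ x)) n - P (+ x / 1) ∣ ℚ.≤ (θ + θ) + (θ + θ)
  rationalise θ 0<θ X = P , dP , ℚ.+-inverseʳ (evalℚ p′ 0ℚ) , K , close
    where
    modulus₁ modulus₂ : ℕ → ℕ
    modulus₁ x = proj₁ (cauchy (eval p (fromℕ x)) θ 0<θ)
    modulus₂ x = proj₁ (eval-take (2 ℕ.+ k) p (+ x / 1) high θ 0<θ)
    M₁ = maxBelow modulus₁ (suc X)
    M₂ = maxBelow modulus₂ (suc X)
    M₃ = proj₁ (p0 θ 0<θ)
    K = (M₁ ℕ.⊔ M₂) ℕ.⊔ M₃
    M₁≤K : M₁ ≤ K
    M₁≤K = ℕ.≤-trans (ℕ.m≤m⊔n M₁ M₂) (ℕ.m≤m⊔n (M₁ ℕ.⊔ M₂) M₃)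
    M₂≤K : M₂ ≤ K
    M₂≤K = ℕ.≤-trans (ℕ.m≤n⊔m M₁ M₂) (ℕ.m≤m⊔n (M₁ ℕ.⊔ M₂) M₃)
    p′ = coefficients K (take (2 ℕ.+ k) p)
    P : ℚ → ℚ
    P x = evalℚ p′ x - evalℚ p′ 0ℚ
    dP : Polynomial.Deg< (2 ℕ.+ k) P
    dP = Polynomial.Deg<-- (2 ℕ.+ k) {evalℚ p′} {λ _ → evalℚ p′ 0ℚ} (Deg<-evalℚ (2 ℕ.+ k) p′ (ℕ.≤-trans (ℕ.≤-reflexive
           (trans (List.length-map (λ a → seq a K) (take (2 ℕ.+ k) p)) (List.length-take (2 ℕ.+ k) p))) (ℕ.m⊓n≤m _ _)))
         (Polynomial.Deg<-const (suc k) (evalℚ p′ 0ℚ))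
    truncated : ∀ x → x ≤ X → ∣ seq (eval p (fromℕ x)) K - evalℚ p′ (+ x / 1) ∣ ℚ.< θ
    truncated x x≤X = subst (λ z → ∣ seq (eval p (fromℕ x)) K - z ∣ ℚ.< θ)
      (seq-eval (take (2 ℕ.+ k) p) (fromℕ x) K)
      (proj₂ (eval-take (2 ℕ.+ k) p (+ x / 1) high θ 0<θ) K
        (ℕ.≤-trans (≤-maxBelow modulus₂ (ℕ.s≤s x≤X)) M₂≤K))
    close : ∀ x n → x ≤ X → K ≤ n → ∣ seq (eval p (fromℕ x)) n - P (+ x / 1) ∣ ℚ.≤ (θ + θ) + (θ + θ)
    close x n x≤X K≤n = begin
      ∣ a - (b - c) ∣                          ≡⟨ cong ∣_∣ (solve 5 (λ a a′ b c d → a :- (b :- c) := ((a :- a′) :+ (a′ :- b)) :+ ((:- (d :- c)) :+ (d :- con 0ℚ))) refl a a′ b c d) ⟩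
      ∣ ((a - a′) + (a′ - b)) + (- (d - c) + (d - 0ℚ)) ∣
                                               ≤⟨ ℚ.∣p+q∣≤∣p∣+∣q∣ ((a - a′) + (a′ - b)) (- (d - c) + (d - 0ℚ)) ⟩
      ∣ (a - a′) + (a′ - b) ∣ + ∣ - (d - c) + (d - 0ℚ) ∣
                                               ≤⟨ ℚ.+-mono-≤ (ℚ.∣p+q∣≤∣p∣+∣q∣ (a - a′) (a′ - b)) (ℚ.∣p+q∣≤∣p∣+∣q∣ (- (d - c)) (d - 0ℚ)) ⟩
      (∣ a - a′ ∣ + ∣ a′ - b ∣) + (∣ - (d - c) ∣ + ∣ d - 0ℚ ∣)
                                               ≡⟨ cong (λ z → (∣ a - a′ ∣ + ∣ a′ - b ∣) + (z + ∣ d - 0ℚ ∣)) (ℚ.∣-p∣≡∣p∣ (d - c)) ⟩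
      (∣ a - a′ ∣ + ∣ a′ - b ∣) + (∣ d - c ∣ + ∣ d - 0ℚ ∣)
                                               ≤⟨ ℚ.+-mono-≤ (ℚ.+-mono-≤ (ℚ.<⇒≤ cauchy-θ) (ℚ.<⇒≤ (truncated x x≤X)))
                                                    (ℚ.+-mono-≤ (ℚ.<⇒≤ (truncated 0 ℕ.z≤n)) (ℚ.<⇒≤ (proj₂ (p0 θ 0<θ) K (ℕ.m≤n⊔m (M₁ ℕ.⊔ M₂) M₃)))) ⟩
      (θ + θ) + (θ + θ)                        ∎
      where
      open ℚ.≤-Reasoning
      a = seq (eval p (fromℕ x)) n
      a′ = seq (eval p (fromℕ x)) K
      b = evalℚ p′ (+ x / 1)
      c = evalℚ p′ 0ℚ
      d = seq (eval p 0ℝ) K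
      x-modulus : modulus₁ x ≤ K
      x-modulus = ℕ.≤-trans (≤-maxBelow modulus₁ (ℕ.s≤s x≤X)) M₁≤K
      cauchy-θ : ∣ a - a′ ∣ ℚ.< θ
      cauchy-θ = proj₂ (cauchy (eval p (fromℕ x)) θ 0<θ) n K (ℕ.≤-trans x-modulus K≤n) x-modulus

theoremA : (p : Poly) (d : ℕ) → 1 ≤ d → HasDegree p d → eval p 0ℝ ≈ 0ℝ →
    (n : ℕ → ℕ) → (∀ i → 1 ≤ i → 1 ≤ n i) →
    (ε : ℝ) → 0ℝ <ᴿ ε →
    ∃[ α ] 𝒮 d α × ‖ eval p (fromℕ (∑[ α ] n)) ‖ℝ/ℤ ≤ᴿ ε
theoremA p (suc k) _ (_ , high) p0 n _ ε (η , 0<η , Nε , η≤ε) =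
  withBound (almostIntegral 0<½η)
  where
  open Differences k using (AlmostIntegral; almostIntegral; value; size; others)
  open Detours k using (coverWord)
  open Covering k
  0<½η : 0ℚ ℚ.< ½ * η
  0<½η = ½-pos 0<η
  -- The approximation error `4 θ` takes one half of `η`, `almostIntegral` the other.
  θ : ℚ
  θ = ½ * (½ * (½ * η))
  Goal : Set
  Goal = ∃[ α ] 𝒮 (suc k) α × ‖ eval p (fromℕ (∑[ α ] n)) ‖ℝ/ℤ ≤ᴿ ε
  withBound : ∃[ N ] AlmostIntegral (½ * η) N → Goal
  -- `N` bounds the possible sums and thereby the range of the approximation; the word and its times
  -- are chosen afterwards.
  withBound (N , ai) = withPolynomial (rationalise k p high p0 θ (½-pos (½-pos 0<½η)) (sum (map n (map ℕ.suc (qs n N)))))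
    where
    withPolynomial : ∃[ P ] Polynomial.Deg< (2 ℕ.+ k) P × P 0ℚ ≡ 0ℚ ×
      (∃[ K ] ∀ x m → x ≤ sum (map n (map ℕ.suc (qs n N))) → K ≤ m →
        ∣ seq (eval p (fromℕ x)) m - P (+ x / 1) ∣ ℚ.≤ (θ + θ) + (θ + θ)) → Goal
    withPolynomial (P , dP , P0 , K , close) =
      build (ai (tailSum n N) P dP P0 (upTo N) (ℕ.≤-reflexive (sym (List.length-upTo N))))
      where
      build : ∃[ e ] ∃[ ts ] ts ⊆ upTo N × length ts ≡ size e ×
              Near (½ * η) (P (value (tailSum n N) (coverWord e others) ts)) → Goal
      -- `size e` is a successor, so the list of times is not empty.
      build (e , t ∷ ts , ts⊆ , len , integral) = α , coverSet-𝒮 n N e t<N inc len , small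
        where
        t<N : t ℕ.< N
        t<N = All.head (All-resp-⊆ ts⊆ (All.applyUpTo⁺₁ id N (λ i<N → i<N)))
        inc : AllPairs ℕ._<_ (t ∷ ts)
        inc = AllPairs-resp-⊆ ts⊆ (AllPairs.applyUpTo⁺₁ id N (λ i<j _ → i<j))
        α : FinSet⁺
        α = coverSet n N e t<N inc len
        x : ℕ
        x = ∑[ α ] n
        integral′ : Near (½ * η) (P (+ x / 1))
        integral′ = subst (λ z → Near (½ * η) (P z)) (sym (coverSet-sum n N e t<N inc len)) integral
        small : ‖ eval p (fromℕ x) ‖ℝ/ℤ ≤ᴿ ε
        small ε′ 0<ε′ = K ℕ.⊔ Nε , λ m le → begin
          distℤ (seq (eval p (fromℕ x)) m)   ≤⟨ Near⇒distℤ≤ (near-m m (ℕ.m⊔n≤o⇒m≤o K Nε le)) ⟩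
          η                                  ≡⟨ ℚ.+-identityˡ η ⟨
          0ℚ + η                             ≤⟨ η≤ε m (ℕ.m⊔n≤o⇒n≤o K Nε le) ⟩
          seq ε m                            ≡⟨ ℚ.+-identityʳ (seq ε m) ⟨
          seq ε m + 0ℚ                       ≤⟨ ℚ.+-monoʳ-≤ (seq ε m) (ℚ.<⇒≤ 0<ε′) ⟩
          seq ε m + ε′                       ∎
          where
          open ℚ.≤-Reasoning
          near-m : ∀ m → K ≤ m → Near η (seq (eval p (fromℕ x)) m)
          near-m m K≤m = subst₂ Near
            (trans (cong (_+ ½ * η) (trans (cong₂ _+_ (½-split (½ * (½ * η))) (½-split (½ * (½ * η)))) (½-split (½ * η)))) (½-split η))
            (solve 2 (λ a b → (a :- b) :+ b := a) refl (seq (eval p (fromℕ x)) m) (P (+ x / 1)))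
            (Near-+ (Near-∣∣ (close x m (coverSet-≤ n N e t<N inc len) K≤m)) integral′)
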